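{- For every integer $k\ge 2$ there is a constant $c_k>0$ (depending only on $k$) such that for all integers $n\ge k$, \[ D(n,k)\ \ge\ c_k\,\frac{2^n\log n}{n^{2k}}. \] That is, $D(n,k)\ge \Omega_k(2^n\log n/n^{2k})$.
   Context: Words are finite binary strings. A word $w$ is a subsequence of $u$ if $w$ is obtained from $u$ by deleting some letters. For $u,v\in\{0,1\}^n$, $\mathrm{LCS}(u,v)$ is the maximum length of a common subsequence of $u$ and $v$, and the deletion distance is $\mathrm{d}(u,v)=n-\mathrm{LCS}(u,v)$. A set $C\subseteq\{0,1\}^n$ is a $k$-deletion code if every pair of distinct words in $C$ has deletion distance greater than $k$ (equivalently, no word of length $n-k$ is a subsequence of two distinct words of $C$). $D(n,k)$ denotes the maximum size of a $k$-deletion code $C\subseteq\{0,1\}^n$. Logarithms are base $2$. -}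

module Defs where

open import Data.Bool using (Bool)
open import Data.Nat using (ℕ; _≤_; _<_; _∸_)
open import Data.List using (List; length)
open import Data.List.Relation.Unary.All using (All)
open import Data.List.Relation.Unary.AllPairs using (AllPairs)
open import Data.List.Relation.Binary.Sublist.Propositional using (_⊆_)
open import Data.Product using (_×_; ∃-syntax)
open import Relation.Binary.PropositionalEquality using (_≡_; _≢_)
open import Relation.Nullary using (¬_)

Word : Set
Word = List Bool

CommonSubseq : Word → Word → Word → Set
CommonSubseq w u v = (w ⊆ u) × (w ⊆ v)

-- For u, v ∈ {0,1}^n:  d(u,v) > k  ⇔  LCS(u,v) < n - k
--                               ⇔  no common subsequence of length ≥ n - k.
DistGt : ℕ → ℕ → Word → Word → Set
DistGt n k u v = ¬ (∃[ w ] (CommonSubseq w u v × (n ∸ k ≤ length w)))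

IsDeletionCode : ℕ → ℕ → List Word → Set
IsDeletionCode n k C =
  All (λ u → length u ≡ n) C ×
  AllPairs _≢_ C ×
  AllPairs (DistGt n k) C

{-# OPTIONS --safe #-}

-- Join two words of length n when at most 2k single-letter edits lead from one to the other: codes are the independent
-- sets of this graph, whose degrees are O(n^{2k}). Keep only the words made of about √n aperiodic blocks, which is at
-- least half of them. There each neighbourhood spans only O(n^{4k - 1/2}) edges: if v and w are neighbours of u and of
-- each other, then following the three alignments around the triangle u, v, w defines an offset at each block boundary,
-- which vanishes at unedited aperiodic blocks and changes parity with each edit. So unless the edits leading to v and w
-- are matched by edits between v and w, hence number at most 2k, two of them lie in the same or in adjacent blocks.
--
-- Now draw an independent set I from the hard-core model with fugacity about n^{1/4 - 2k}. Condition on the part of I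
-- outside v and its neighbours. If few neighbours of v remain free then v is likely to be in I, and if many remain free
-- then many of them are in I since they span few edges. So n^{2k} [v ∈ I] + |N(v) ∩ I| has expectation of order log n for
-- every v, and summing over v yields a large I.
module Submission where

open import Defs
open import Data.Bool using (Bool; true; false; not; _∧_; _xor_)
import Data.Bool.Properties as Boolₚ
open import Data.Empty using (⊥; ⊥-elim)
open import Data.List using (List; []; _∷_; _++_; length; map; concat; concatMap; filter; replicate; upTo; cartesianProduct; cartesianProductWith)
open import Data.List.Membership.Propositional using (_∈_; lose)
import Data.List.Membership.DecPropositional as DecMembership
open import Data.List.Membership.Propositional.Properties
open import Data.List.Properties using (length-++; ++-assoc; ++-cancelˡ; ++-identityʳ; ∷-injectiveˡ; ∷-injectiveʳ; length-map; length-upTo; length-replicate; ≡-dec)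
open import Data.List.Relation.Binary.Permutation.Propositional using (_↭_; prep; swap; ↭-sym; ↭-trans; ↭-refl)
open import Data.List.Relation.Binary.Permutation.Propositional.Properties using (shift)
open import Data.List.Relation.Binary.Sublist.Propositional using (_⊆_; []; _∷_; _∷ʳ_; ⊆-refl; ⊆-trans)
import Data.List.Relation.Binary.Sublist.Propositional.Properties as Subₚ
open import Data.List.Relation.Unary.All as All using (All; []; _∷_)
import Data.List.Relation.Unary.All.Properties as Allₚ
open import Data.List.Relation.Unary.AllPairs using (AllPairs; []; _∷_)
open import Data.List.Relation.Unary.Any using (here; there)
open import Data.List.Relation.Unary.Unique.Propositional using (Unique)
import Data.List.Relation.Unary.Unique.Propositional.Properties as Uniqueₚ
open import Data.Nat using (ℕ; zero; suc; _+_; _*_; _^_; _∸_; _≤_; _<_; z≤n; s≤s; _≤?_; _<?_; NonZero; >-nonZero; >-nonZero⁻¹; _/_; _%_)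
open import Data.Nat.DivMod using (m≡m%n+[m/n]*n; m%n<n; m/n*n≤m; m*n/n≡m; /-monoˡ-≤; m<n*o⇒m/o<n)
open import Data.Nat.ListAction using (sum)
open import Data.Nat.Properties
open import Data.Nat.Tactic.RingSolver using (solve-∀)
open import Data.Product using (_×_; _,_; proj₁; ∃-syntax)
open import Data.Sum using (_⊎_; inj₁; inj₂)
open import Function.Bundles using (mk⇔)
open import Relation.Binary.Definitions using (DecidableEquality; tri<; tri≈; tri>)
open import Relation.Binary.PropositionalEquality using (_≡_; _≢_; refl; sym; trans; cong; cong₂; subst; subst₂; module ≡-Reasoning)
open import Relation.Nullary using (¬_; Dec; yes; no; does; ¬?)
open import Relation.Nullary.Decidable using (⌊_⌋; _×-dec_; map′; dec-true; does-⇔)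

-- Periodic stretches are the obstacle: there a shift by one period goes unnoticed, so an offset can
-- survive unedited blocks and link two edits that are far apart. The exponents are tied together as
-- follows, with d = 2k. Up to 2d edits lead from u to a pair v, w. If two of them lie in one of
-- O(√n) windows of length O(√n), there remain about n^(2d-2) · √n · n pairs. Edges inside a
-- neighbourhood do little harm once the square of the inverse fugacity L exceeds this number, so L
-- is about n^(d-1/4). The factor n^(1/4) between L and the degree bound n^d is the source of the
-- logarithm. A vertex with O(tL) free neighbours is occupied with probability of order at least
-- 2^(-8t)/L, and multiplied by n^d this is at least of order t as long as t · 2^(8t) ≤ n^(1/4),
-- which allows t of order log n. Probabilities and expectations never appear as fractions: each
-- inequality between them is multiplied by the partition function.

⟦_⟧ : Bool → ℕ
⟦ true ⟧ = 1
⟦ false ⟧ = 0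

⟦∧⟧ : ∀ a b → ⟦ a ∧ b ⟧ ≡ ⟦ a ⟧ * ⟦ b ⟧
⟦∧⟧ true b = sym (+-identityʳ ⟦ b ⟧)
⟦∧⟧ false b = refl

⟦⟧≤1 : ∀ b → ⟦ b ⟧ ≤ 1
⟦⟧≤1 true = ≤-refl
⟦⟧≤1 false = z≤n

-- Sums over lists

module _ {A : Set} where

  ∑ : (A → ℕ) → List A → ℕ
  ∑ f [] = 0
  ∑ f (x ∷ xs) = f x + ∑ f xs

  ∑-mono : ∀ {f g : A → ℕ} xs → (∀ {x} → x ∈ xs → f x ≤ g x) → ∑ f xs ≤ ∑ g xs
  ∑-mono [] h = z≤n
  ∑-mono (x ∷ xs) h = +-mono-≤ (h (here refl)) (∑-mono xs (λ i → h (there i)))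

  ∑-+ : ∀ (f g : A → ℕ) xs → ∑ (λ x → f x + g x) xs ≡ ∑ f xs + ∑ g xs
  ∑-+ f g [] = refl
  ∑-+ f g (x ∷ xs) rewrite ∑-+ f g xs = interchange (f x) (g x) (∑ f xs) (∑ g xs)
    where
    interchange : ∀ a b c e → a + b + (c + e) ≡ a + c + (b + e)
    interchange = solve-∀

  ∑-const : ∀ c xs → ∑ (λ _ → c) xs ≡ length xs * c
  ∑-const c [] = refl
  ∑-const c (x ∷ xs) = cong (c +_) (∑-const c xs)

  ∑-* : ∀ c (f : A → ℕ) xs → ∑ (λ x → c * f x) xs ≡ c * ∑ f xs
  ∑-* c f [] = sym (*-zeroʳ c)
  ∑-* c f (x ∷ xs) rewrite ∑-* c f xs = sym (*-distribˡ-+ c (f x) (∑ f xs))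

  ∑-++ : ∀ (f : A → ℕ) xs ys → ∑ f (xs ++ ys) ≡ ∑ f xs + ∑ f ys
  ∑-++ f [] ys = refl
  ∑-++ f (x ∷ xs) ys rewrite ∑-++ f xs ys = sym (+-assoc (f x) (∑ f xs) (∑ f ys))

  ∑-↭ : ∀ (f : A → ℕ) {xs ys} → xs ↭ ys → ∑ f xs ≡ ∑ f ys
  ∑-↭ f _↭_.refl = refl
  ∑-↭ f (prep x p) = cong (f x +_) (∑-↭ f p)
  ∑-↭ f (swap {xs} {ys} x y p) rewrite ∑-↭ f p = exchange (f x) (f y) (∑ f ys)
    where
    exchange : ∀ a b c → a + (b + c) ≡ b + (a + c)
    exchange = solve-∀
  ∑-↭ f (_↭_.trans p q) = trans (∑-↭ f p) (∑-↭ f q)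

∑-swap : ∀ {A B : Set} (f : A → B → ℕ) xs ys →
  ∑ (λ x → ∑ (f x) ys) xs ≡ ∑ (λ y → ∑ (λ x → f x y) xs) ys
∑-swap f [] ys = sym (trans (∑-const 0 ys) (*-zeroʳ (length ys)))
∑-swap f (x ∷ xs) ys rewrite ∑-swap f xs ys = sym (∑-+ (f x) (λ y → ∑ (λ x → f x y) xs) ys)

-- Telescoping: `c ≤ L` gives 1 + 1/L ≤ (c + 1)/c, and the product of (c + 1)/c over the i
-- consecutive values ending at L - 1 is L/(L - i).
suc-^≤ : ∀ L i c → c + i ≡ L → suc L ^ i * c ≤ L ^ i * L
suc-^≤ L zero c eq = *-monoʳ-≤ 1 (≤-reflexive (trans (sym (+-identityʳ c)) eq))
suc-^≤ L (suc i) c eq = begin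
  suc L * suc L ^ i * c          ≡⟨ assoc₁ (suc L) (suc L ^ i) c ⟩
  suc L ^ i * (c + L * c)        ≤⟨ *-monoʳ-≤ (suc L ^ i) (+-monoˡ-≤ (L * c) c≤L) ⟩
  suc L ^ i * (L + L * c)        ≡⟨ assoc₂ (suc L ^ i) L c ⟩
  suc L ^ i * suc c * L          ≤⟨ *-monoˡ-≤ L (suc-^≤ L i (suc c) (trans (sym (+-suc c i)) eq)) ⟩
  L ^ i * L * L                  ≡⟨ assoc₃ (L ^ i) L ⟩
  L * L ^ i * L                  ∎
  where
  open ≤-Reasoning
  c≤L : c ≤ L
  c≤L = subst (c ≤_) eq (m≤m+n c (suc i))
  assoc₁ : ∀ a b c → a * b * c ≡ b * (a * c)
  assoc₁ = solve-∀
  assoc₂ : ∀ a b c → a * (b + b * c) ≡ a * (1 + c) * b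
  assoc₂ = solve-∀
  assoc₃ : ∀ a b → a * b * b ≡ b * a * b
  assoc₃ = solve-∀

-- (1 + 1/L)^x ≤ 1/(1 − x/L) ≤ 2 as long as x ≤ L/2.
suc-^≤2 : ∀ H .{{_ : NonZero H}} L → L ≡ 2 * H → ∀ x → x ≤ H → suc L ^ x ≤ 2 * L ^ x
suc-^≤2 H L eq x x≤H = *-cancelʳ-≤ _ _ H (begin
  suc L ^ x * H              ≤⟨ *-monoʳ-≤ (suc L ^ x) H≤c ⟩
  suc L ^ x * c              ≤⟨ suc-^≤ L x c c+x≡L ⟩
  L ^ x * L                  ≡⟨ cong (L ^ x *_) eq ⟩
  L ^ x * (2 * H)            ≡⟨ assoc (L ^ x) H ⟩
  2 * L ^ x * H              ∎)
  where
  open ≤-Reasoning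
  c = H + (H ∸ x)
  H≤c : H ≤ c
  H≤c = m≤m+n H (H ∸ x)
  c+x≡L : c + x ≡ L
  c+x≡L = trans (+-assoc H (H ∸ x) x) (trans (cong (H +_) (m∸n+n≡m x≤H))
            (trans (cong (H +_) (sym (+-identityʳ H))) (sym eq)))
  assoc : ∀ a b → a * (2 * b) ≡ 2 * a * b
  assoc = solve-∀

-- The exponent is cut into `s` stretches of length at most `H`, each costing a factor 2. This
-- limits the partition function of a set of at most `s * H` vertices.
suc-^≤2^ : ∀ H .{{_ : NonZero H}} L → L ≡ 2 * H → ∀ s x → x ≤ s * H → suc L ^ x ≤ 2 ^ s * L ^ x
suc-^≤2^ H L eq zero zero _ = ≤-refl
suc-^≤2^ H L eq (suc s) x x≤ with x ≤? H
... | yes x≤H = ≤-trans (suc-^≤2 H L eq x x≤H) (*-monoˡ-≤ (L ^ x) (*-monoʳ-≤ 2 (m^n>0 2 s)))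
... | no x≰H = begin
  suc L ^ x                                ≡⟨ cong (suc L ^_) x≡ ⟨
  suc L ^ (H + y)                          ≡⟨ ^-distribˡ-+-* (suc L) H y ⟩
  suc L ^ H * suc L ^ y                    ≤⟨ *-mono-≤ (suc-^≤2 H L eq H ≤-refl) (suc-^≤2^ H L eq s y y≤) ⟩
  2 * L ^ H * (2 ^ s * L ^ y)              ≡⟨ assoc (L ^ H) (2 ^ s) (L ^ y) ⟩
  2 * 2 ^ s * (L ^ H * L ^ y)              ≡⟨ cong (2 * 2 ^ s *_) (^-distribˡ-+-* L H y) ⟨
  2 * 2 ^ s * L ^ (H + y)                  ≡⟨ cong (λ z → 2 * 2 ^ s * L ^ z) x≡ ⟩
  2 * 2 ^ s * L ^ x                        ∎
  where
  open ≤-Reasoning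
  y = x ∸ H
  x≡ : H + y ≡ x
  x≡ = m+[n∸m]≡n (≰⇒≥ x≰H)
  y≤ : y ≤ s * H
  y≤ = +-cancelˡ-≤ H y (s * H) (subst (_≤ H + s * H) (sym x≡) x≤)
  assoc : ∀ a b c → 2 * a * (b * c) ≡ 2 * b * (a * c)
  assoc = solve-∀

-- Partition functions of the hard-core model on a list of vertices: W φ xs sums φ over the sublists I of xs,
-- with weight L ^ (length xs ∸ length I), i.e. fugacity 1/L with the denominators cleared.
module HardCore {A : Set} (adj : A → A → Bool) (adj-sym : ∀ x y → adj x y ≡ adj y x) (L : ℕ) where

  W : (List A → ℕ) → List A → ℕ
  W φ [] = φ []
  W φ (x ∷ xs) = L * W φ xs + W (λ I → φ (x ∷ I)) xs

  W-mono : ∀ {φ ψ : List A → ℕ} xs → (∀ {I} → I ⊆ xs → φ I ≤ ψ I) → W φ xs ≤ W ψ xs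
  W-mono [] h = h []
  W-mono (x ∷ xs) h =
    +-mono-≤ (*-monoʳ-≤ L (W-mono xs (λ s → h (x ∷ʳ s)))) (W-mono xs (λ s → h (refl ∷ s)))

  W-cong : ∀ {φ ψ : List A → ℕ} xs → (∀ {I} → I ⊆ xs → φ I ≡ ψ I) → W φ xs ≡ W ψ xs
  W-cong xs h = ≤-antisym (W-mono xs (λ s → ≤-reflexive (h s))) (W-mono xs (λ s → ≤-reflexive (sym (h s))))

  W-+ : ∀ (φ ψ : List A → ℕ) xs → W (λ I → φ I + ψ I) xs ≡ W φ xs + W ψ xs
  W-+ φ ψ [] = refl
  W-+ φ ψ (x ∷ xs) rewrite W-+ φ ψ xs | W-+ (λ I → φ (x ∷ I)) (λ I → ψ (x ∷ I)) xs =
    distrib L (W φ xs) (W ψ xs) (W (λ I → φ (x ∷ I)) xs) (W (λ I → ψ (x ∷ I)) xs)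
    where
    distrib : ∀ l a b c e → l * (a + b) + (c + e) ≡ l * a + c + (l * b + e)
    distrib = solve-∀

  W-* : ∀ c (φ : List A → ℕ) xs → W (λ I → c * φ I) xs ≡ c * W φ xs
  W-* c φ [] = refl
  W-* c φ (x ∷ xs) rewrite W-* c φ xs | W-* c (λ I → φ (x ∷ I)) xs =
    distrib L c (W φ xs) (W (λ I → φ (x ∷ I)) xs)
    where
    distrib : ∀ l c a b → l * (c * a) + c * b ≡ c * (l * a + b)
    distrib = solve-∀

  W-*ʳ : ∀ c (φ : List A → ℕ) xs → W (λ I → φ I * c) xs ≡ W φ xs * c
  W-*ʳ c φ xs = trans (W-cong xs (λ {I} _ → *-comm (φ I) c)) (trans (W-* c φ xs) (*-comm c (W φ xs)))

  -- Conditioning on the part `J` of the random set that lies in `ys`.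
  W-++ : ∀ (φ : List A → ℕ) xs ys → W φ (xs ++ ys) ≡ W (λ J → W (λ I → φ (I ++ J)) xs) ys
  W-++ φ [] ys = refl
  W-++ φ (x ∷ xs) ys = begin
    L * W φ (xs ++ ys) + W (λ I → φ (x ∷ I)) (xs ++ ys)
      ≡⟨ cong₂ (λ a b → L * a + b) (W-++ φ xs ys) (W-++ (λ I → φ (x ∷ I)) xs ys) ⟩
    L * W F ys + W G ys
      ≡⟨ cong (_+ W G ys) (W-* L F ys) ⟨
    W (λ J → L * F J) ys + W G ys
      ≡⟨ W-+ (λ J → L * F J) G ys ⟨
    W (λ J → L * F J + G J) ys ∎
    where
    open ≡-Reasoning
    F G : List A → ℕ
    F J = W (λ I → φ (I ++ J)) xs
    G J = W (λ I → φ (x ∷ I ++ J)) xs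

  W-∑ : ∀ {B : Set} (φ : B → List A → ℕ) bs xs → W (λ I → ∑ (λ b → φ b I) bs) xs ≡ ∑ (λ b → W (φ b) xs) bs
  W-∑ φ [] xs = W-* 0 (λ _ → 0) xs
  W-∑ φ (b ∷ bs) xs = trans (W-+ (φ b) (λ I → ∑ (λ b → φ b I) bs) xs) (cong (W (φ b) xs +_) (W-∑ φ bs xs))

  W-↭ : ∀ (φ : List A → ℕ) → (∀ {I J} → I ↭ J → φ I ≡ φ J) → ∀ {xs ys} → xs ↭ ys → W φ xs ≡ W φ ys
  W-↭ φ φ-↭ _↭_.refl = refl
  W-↭ φ φ-↭ (prep x p) =
    cong₂ (λ a b → L * a + b) (W-↭ φ φ-↭ p) (W-↭ (λ I → φ (x ∷ I)) (λ q → φ-↭ (prep x q)) p)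
  W-↭ φ φ-↭ (swap {xs} {ys} x y p) = begin
    L * (L * W φ xs + W φy xs) + (L * W φx xs + W φxy xs)
      ≡⟨ exchange L (W φ xs) (W φy xs) (W φx xs) (W φxy xs) ⟩
    L * (L * W φ xs + W φx xs) + (L * W φy xs + W φxy xs)
      ≡⟨ cong₂ _+_ (cong₂ (λ a b → L * (L * a + b)) (W-↭ φ φ-↭ p) (W-↭ φx (λ q → φ-↭ (prep x q)) p))
                   (cong₂ (λ a b → L * a + b) (W-↭ φy (λ q → φ-↭ (prep y q)) p)
                     (trans (W-↭ φxy (λ q → φ-↭ (prep x (prep y q))) p)
                            (W-cong ys (λ _ → φ-↭ (swap x y ↭-refl))))) ⟩
    L * (L * W φ ys + W φx ys) + (L * W φy ys + W (λ I → φ (y ∷ x ∷ I)) ys) ∎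
    where
    open ≡-Reasoning
    φx φy φxy : List A → ℕ
    φx I = φ (x ∷ I)
    φy I = φ (y ∷ I)
    φxy I = φ (x ∷ y ∷ I)
    exchange : ∀ l a b c e → l * (l * a + b) + (l * c + e) ≡ l * (l * a + c) + (l * b + e)
    exchange = solve-∀
  W-↭ φ φ-↭ (_↭_.trans p q) = trans (W-↭ φ φ-↭ p) (W-↭ φ φ-↭ q)

  W-1 : ∀ xs → W (λ _ → 1) xs ≡ suc L ^ length xs
  W-1 [] = refl
  W-1 (x ∷ xs) rewrite W-1 xs = +-comm (L * suc L ^ length xs) (suc L ^ length xs)

  W-[] : ∀ (φ : List A → ℕ) xs → L ^ length xs * φ [] ≤ W φ xs
  W-[] φ [] = ≤-reflexive (+-identityʳ (φ []))
  W-[] φ (x ∷ xs) = begin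
    L * L ^ length xs * φ []      ≡⟨ *-assoc L (L ^ length xs) (φ []) ⟩
    L * (L ^ length xs * φ [])    ≤⟨ *-monoʳ-≤ L (W-[] φ xs) ⟩
    L * W φ xs                    ≤⟨ m≤m+n _ _ ⟩
    L * W φ xs + W _ xs           ∎
    where open ≤-Reasoning

  W-only-[] : ∀ (φ : List A → ℕ) xs → (∀ {x I} → x ∷ I ⊆ xs → φ (x ∷ I) ≡ 0) → W φ xs ≡ L ^ length xs * φ []
  W-only-[] φ [] h = sym (+-identityʳ (φ []))
  W-only-[] φ (x ∷ xs) h = begin
    L * W φ xs + W (λ I → φ (x ∷ I)) xs
      ≡⟨ cong₂ (λ a b → L * a + b) (W-only-[] φ xs (λ s → h (x ∷ʳ s)))
           (trans (W-cong xs (λ s → h (refl ∷ s))) (W-* 0 (λ _ → 0) xs)) ⟩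
    L * (L ^ length xs * φ []) + 0
      ≡⟨ trans (+-identityʳ _) (sym (*-assoc L (L ^ length xs) (φ []))) ⟩
    L * L ^ length xs * φ [] ∎
    where open ≡-Reasoning

  ∏ : (A → Bool) → List A → ℕ
  ∏ p [] = 1
  ∏ p (x ∷ xs) = ⟦ p x ⟧ * ∏ p xs

  -- A vertex failing `p` can only stay out of the sublist, where it contributes a bare factor `L`;
  -- `F` collects the other vertices. The same `F` and `e` serve every `ψ`, so the partition
  -- function and the expected size can be restricted together.
  W-restrict : ∀ (p : A → Bool) xs → ∃[ F ] ∃[ e ] (F ⊆ xs × length xs ≡ e + length F ×
    (∀ (ψ : List A → ℕ) → W (λ I → ∏ p I * ψ I) xs ≡ L ^ e * W ψ F))
  W-restrict p [] = [] , 0 , [] , refl , λ ψ → refl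
  W-restrict p (x ∷ xs) with W-restrict p xs | p x
  ... | F , e , F⊆ , len , W≡ | true = x ∷ F , e , refl ∷ F⊆ , trans (cong suc len) (sym (+-suc e (length F))) , λ ψ → begin
    L * W (λ I → ∏ p I * ψ I) xs + W (λ I → ⟦ true ⟧ * ∏ p I * ψ (x ∷ I)) xs
      ≡⟨ cong₂ (λ a b → L * a + b) (W≡ ψ)
           (trans (W-cong xs (λ {I} _ → cong (_* ψ (x ∷ I)) (+-identityʳ (∏ p I))))
                  (W≡ (λ I → ψ (x ∷ I)))) ⟩
    L * (L ^ e * W ψ F) + L ^ e * W (λ I → ψ (x ∷ I)) F
      ≡⟨ distrib L (L ^ e) (W ψ F) _ ⟩
    L ^ e * (L * W ψ F + W (λ I → ψ (x ∷ I)) F) ∎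
    where
    open ≡-Reasoning
    distrib : ∀ l a b c → l * (a * b) + a * c ≡ a * (l * b + c)
    distrib = solve-∀
  ... | F , e , F⊆ , len , W≡ | false = F , suc e , x ∷ʳ F⊆ , cong suc len , λ ψ → begin
    L * W (λ I → ∏ p I * ψ I) xs + W (λ I → ⟦ false ⟧ * ∏ p I * ψ (x ∷ I)) xs
      ≡⟨ cong₂ (λ a b → L * a + b) (W≡ ψ)
           (W-* 0 (λ _ → 0) xs) ⟩
    L * (L ^ e * W ψ F) + 0
      ≡⟨ trans (+-identityʳ _) (sym (*-assoc L (L ^ e) (W ψ F))) ⟩
    L * L ^ e * W ψ F ∎
    where open ≡-Reasoning

  -- Occupancy in the hard-core model

  isFree : A → List A → Bool
  isFree x [] = true
  isFree x (y ∷ I) = not (adj x y) ∧ isFree x I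

  ind : List A → ℕ
  ind [] = 1
  ind (x ∷ I) = ⟦ isFree x I ⟧ * ind I

  hits : A → List A → ℕ
  hits x = ∑ (λ y → ⟦ adj x y ⟧)

  -- For `I = F` these are ordered pairs: every edge spanned by `F` counts twice, and every vertex
  -- adjacent to itself once. In the deletion graph all vertices are adjacent to themselves.
  hits² : List A → List A → ℕ
  hits² F I = ∑ (λ u → hits u I) F

  isFree-↭ : ∀ x {I J} → I ↭ J → isFree x I ≡ isFree x J
  isFree-↭ x _↭_.refl = refl
  isFree-↭ x (prep y p) = cong (not (adj x y) ∧_) (isFree-↭ x p)
  isFree-↭ x (swap y z p) rewrite isFree-↭ x p with adj x y | adj x z
  ... | true | true = refl
  ... | true | false = refl
  ... | false | true = refl
  ... | false | false = refl
  isFree-↭ x (_↭_.trans p q) = trans (isFree-↭ x p) (isFree-↭ x q)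

  ind-↭ : ∀ {I J} → I ↭ J → ind I ≡ ind J
  ind-↭ _↭_.refl = refl
  ind-↭ (prep x p) = cong₂ (λ b n → ⟦ b ⟧ * n) (isFree-↭ x p) (ind-↭ p)
  ind-↭ (swap {xs} {ys} x y p)
    rewrite isFree-↭ x p | isFree-↭ y p | ind-↭ p | adj-sym y x
          | ⟦∧⟧ (not (adj x y)) (isFree x ys) | ⟦∧⟧ (not (adj x y)) (isFree y ys) =
    exchange ⟦ not (adj x y) ⟧ ⟦ isFree x ys ⟧ ⟦ isFree y ys ⟧ (ind ys)
    where
    exchange : ∀ a b c e → a * b * (c * e) ≡ a * c * (b * e)
    exchange = solve-∀
  ind-↭ (_↭_.trans p q) = trans (ind-↭ p) (ind-↭ q)

  ind≤1 : ∀ I → ind I ≤ 1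
  ind≤1 [] = ≤-refl
  ind≤1 (x ∷ I) = *-mono-≤ (⟦⟧≤1 (isFree x I)) (ind≤1 I)

  isFree-++ : ∀ x I J → isFree x (I ++ J) ≡ isFree x I ∧ isFree x J
  isFree-++ x [] J = refl
  isFree-++ x (y ∷ I) J with adj x y
  ... | true = refl
  ... | false = isFree-++ x I J

  ind-++ : ∀ I J → ind (I ++ J) ≡ ∏ (λ x → isFree x J) I * ind I * ind J
  ind-++ [] J = sym (+-identityʳ (ind J))
  ind-++ (x ∷ I) J rewrite isFree-++ x I J | ⟦∧⟧ (isFree x I) (isFree x J) | ind-++ I J =
    exchange ⟦ isFree x I ⟧ ⟦ isFree x J ⟧ (∏ (λ x → isFree x J) I) (ind I) (ind J)
    where
    exchange : ∀ a b c e f → a * b * (c * e * f) ≡ b * c * (a * e) * f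
    exchange = solve-∀

  1≤isFree+hits : ∀ x I → 1 ≤ ⟦ isFree x I ⟧ + hits x I
  1≤isFree+hits x [] = ≤-refl
  1≤isFree+hits x (y ∷ I) with adj x y
  ... | true = s≤s z≤n
  ... | false = 1≤isFree+hits x I

  -- A vertex is occupied with probability at most 1/L, because removing it keeps the set
  -- independent and multiplies the weight by `L`; the rest is linearity. `P` holds the vertices
  -- already put into the set, so that the induction can pass into the occupied branch.
  W-ind-∑ : ∀ (g : A → ℕ) P F →
    L * W (λ I → ind (P ++ I) * ∑ g I) F ≤ W (λ I → ind (P ++ I)) F * ∑ g F
  W-ind-∑ g P [] rewrite *-zeroʳ (ind (P ++ [])) | *-zeroʳ L = z≤n
  W-ind-∑ g P (x ∷ F) = begin
    L * (L * W (λ I → φ I * ∑ g I) F + W (λ I → φ' I * (g x + ∑ g I)) F)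
      ≡⟨ cong (λ z → L * (L * W (λ I → φ I * ∑ g I) F + z)) expand ⟩
    L * (L * W (λ I → φ I * ∑ g I) F + (W φ' F * g x + W (λ I → φ'' I * ∑ g I) F))
      ≡⟨ distrib L (L * W (λ I → φ I * ∑ g I) F) (W φ' F * g x) _ ⟩
    L * (L * W (λ I → φ I * ∑ g I) F) + L * (W φ' F * g x) + L * W (λ I → φ'' I * ∑ g I) F
      ≤⟨ +-mono-≤ (+-mono-≤ (*-monoʳ-≤ L (W-ind-∑ g P F)) (*-monoʳ-≤ L (*-monoˡ-≤ (g x) (W-mono F (λ {I} _ → φ'≤φ I)))))
                  (W-ind-∑ g (x ∷ P) F) ⟩
    L * (W φ F * ∑ g F) + L * (W φ F * g x) + W φ'' F * ∑ g F
      ≤⟨ m≤m+n _ (W φ'' F * g x) ⟩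
    L * (W φ F * ∑ g F) + L * (W φ F * g x) + W φ'' F * ∑ g F + W φ'' F * g x
      ≡⟨ collect L (W φ F) (W φ'' F) (g x) (∑ g F) ⟩
    (L * W φ F + W φ'' F) * (g x + ∑ g F)
      ≡⟨ cong (λ z → (L * W φ F + z) * (g x + ∑ g F)) (W-cong F (λ {I} _ → sym (ind-↭ (shift x P I)))) ⟩
    (L * W φ F + W φ' F) * (g x + ∑ g F) ∎
    where
    open ≤-Reasoning
    φ φ' φ'' : List A → ℕ
    φ I = ind (P ++ I)
    φ' I = ind (P ++ x ∷ I)
    φ'' I = ind (x ∷ P ++ I)
    φ'≤φ : ∀ I → φ' I ≤ φ I
    φ'≤φ I = begin
      φ' I                                ≡⟨ ind-↭ (shift x P I) ⟩
      ⟦ isFree x (P ++ I) ⟧ * φ I         ≤⟨ *-monoˡ-≤ (φ I) (⟦⟧≤1 (isFree x (P ++ I))) ⟩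
      1 * φ I                             ≡⟨ *-identityˡ (φ I) ⟩
      φ I                                 ∎
    expand : W (λ I → φ' I * (g x + ∑ g I)) F ≡ W φ' F * g x + W (λ I → φ'' I * ∑ g I) F
    expand = trans (W-cong F (λ {I} _ → *-distribˡ-+ (φ' I) (g x) (∑ g I)))
      (trans (W-+ (λ I → φ' I * g x) (λ I → φ' I * ∑ g I) F)
        (cong₂ _+_ (W-*ʳ (g x) φ' F) (W-cong F (λ {I} _ → cong (_* ∑ g I) (ind-↭ (shift x P I))))))
    distrib : ∀ l a b c → l * (a + (b + c)) ≡ l * a + l * b + l * c
    distrib = solve-∀
    collect : ∀ l a b c e → l * (a * e) + l * (a * c) + b * e + b * c ≡ (l * a + b) * (c + e)
    collect = solve-∀

  -- A vertex u is either added to I, or already in I, or blocked by a neighbour in I; summed over u ∈ F.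
  W-occupancy : ∀ P F → length F * W (λ I → ind (P ++ I)) F ≤
    L * W (λ I → ind (P ++ I) * length I) F + W (λ I → ind (P ++ I) * (length I + hits² F (P ++ I))) F
  W-occupancy P [] = z≤n
  W-occupancy P (u ∷ F) = begin
    (1 + n) * (L * W φ F + W φ' F)
      ≡⟨ cong (λ z → (1 + n) * (L * W φ F + z)) φ'≡ ⟩
    (1 + n) * (L * W φ F + W φ'' F)
      ≡⟨ split₁ n L (W φ F) (W φ'' F) ⟩
    L * W φ F + L * (n * W φ F) + (W φ'' F + n * W φ'' F)
      ≤⟨ +-mono-≤ (+-mono-≤ (*-monoʳ-≤ L blocked) (*-monoʳ-≤ L (W-occupancy P F)))
                  (+-monoʳ-≤ (W φ'' F) (W-occupancy (u ∷ P) F)) ⟩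
    L * (W φ'' F + X) + L * (L * Y + Z) + (W φ'' F + (L * Y'' + Z''))
      ≡⟨ regroup L (W φ'' F) X Y Z Y'' Z'' ⟩
    L * (L * Y + (W φ'' F + Y'')) + (L * (X + Z) + (W φ'' F + Z''))
      ≤⟨ +-mono-≤ (≤-reflexive (cong (λ z → L * (L * Y + z)) left))
                  (+-mono-≤ (≤-reflexive (cong (L *_) middle)) right) ⟩
    L * (L * Y + W (λ I → φ' I * suc (length I)) F)
      + (L * W (λ I → φ I * (length I + hits² (u ∷ F) (P ++ I))) F
         + W (λ I → φ' I * (suc (length I) + hits² (u ∷ F) (P ++ u ∷ I))) F) ∎
    where
    open ≤-Reasoning
    n = length F
    φ φ' φ'' : List A → ℕ
    φ I = ind (P ++ I)
    φ' I = ind (P ++ u ∷ I)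
    φ'' I = ind (u ∷ P ++ I)
    X = W (λ I → φ I * hits u (P ++ I)) F
    Y = W (λ I → φ I * length I) F
    Z = W (λ I → φ I * (length I + hits² F (P ++ I))) F
    Y'' = W (λ I → φ'' I * length I) F
    Z'' = W (λ I → φ'' I * (length I + hits² F (u ∷ P ++ I))) F
    φ'≡ : W φ' F ≡ W φ'' F
    φ'≡ = W-cong F (λ {I} _ → ind-↭ (shift u P I))
    blocked : W φ F ≤ W φ'' F + X
    blocked = begin
      W φ F                                            ≤⟨ W-mono F (λ {I} _ → pointwise I) ⟩
      W (λ I → φ'' I + φ I * hits u (P ++ I)) F        ≡⟨ W-+ φ'' (λ I → φ I * hits u (P ++ I)) F ⟩
      W φ'' F + X                                      ∎
      where
      pointwise : ∀ I → φ I ≤ φ'' I + φ I * hits u (P ++ I)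
      pointwise I = begin
        φ I                                                          ≡⟨ *-identityʳ (φ I) ⟨
        φ I * 1                                                      ≤⟨ *-monoʳ-≤ (φ I) (1≤isFree+hits u (P ++ I)) ⟩
        φ I * (⟦ isFree u (P ++ I) ⟧ + hits u (P ++ I))              ≡⟨ *-distribˡ-+ (φ I) _ _ ⟩
        φ I * ⟦ isFree u (P ++ I) ⟧ + φ I * hits u (P ++ I)          ≡⟨ cong (_+ φ I * hits u (P ++ I)) (*-comm (φ I) _) ⟩
        φ'' I + φ I * hits u (P ++ I)                                ∎
    left : W φ'' F + Y'' ≡ W (λ I → φ' I * suc (length I)) F
    left = trans (sym (W-+ φ'' (λ I → φ'' I * length I) F))
      (W-cong F (λ {I} _ → trans (sym (*-suc (φ'' I) (length I))) (cong (_* suc (length I)) (sym (ind-↭ (shift u P I))))))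
    middle : X + Z ≡ W (λ I → φ I * (length I + hits² (u ∷ F) (P ++ I))) F
    middle = trans (sym (W-+ (λ I → φ I * hits u (P ++ I)) (λ I → φ I * (length I + hits² F (P ++ I))) F))
      (W-cong F (λ {I} _ → collect (φ I) (hits u (P ++ I)) (length I) (hits² F (P ++ I))))
      where
      collect : ∀ a b c e → a * b + a * (c + e) ≡ a * (c + (b + e))
      collect = solve-∀
    right : W φ'' F + Z'' ≤ W (λ I → φ' I * (suc (length I) + hits² (u ∷ F) (P ++ u ∷ I))) F
    right = ≤-trans (≤-reflexive (sym (W-+ φ'' (λ I → φ'' I * (length I + hits² F (u ∷ P ++ I))) F)))
      (W-mono F (λ {I} _ → begin
        φ'' I + φ'' I * (length I + hits² F (u ∷ P ++ I))
          ≡⟨ *-suc (φ'' I) _ ⟨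
        φ'' I * (suc (length I) + hits² F (u ∷ P ++ I))
          ≡⟨ cong₂ (λ a b → a * (suc (length I) + b)) (sym (ind-↭ (shift u P I))) (sym (hits²-↭ (shift u P I))) ⟩
        φ' I * (suc (length I) + hits² F (P ++ u ∷ I))
          ≤⟨ *-monoʳ-≤ (φ' I) (+-monoʳ-≤ (suc (length I)) (m≤n+m _ (hits u (P ++ u ∷ I)))) ⟩
        φ' I * (suc (length I) + hits² (u ∷ F) (P ++ u ∷ I)) ∎))
      where
      hits²-↭ : ∀ {I J} → I ↭ J → hits² F I ≡ hits² F J
      hits²-↭ {I} {J} p = ≤-antisym (∑-mono F (λ {x} _ → ≤-reflexive (∑-↭ _ p)))
                                    (∑-mono F (λ {x} _ → ≤-reflexive (sym (∑-↭ _ p))))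
    split₁ : ∀ n l a b → (1 + n) * (l * a + b) ≡ l * a + l * (n * a) + (b + n * b)
    split₁ = solve-∀
    regroup : ∀ l a x y z y' z' →
      l * (a + x) + l * (l * y + z) + (a + (l * y' + z')) ≡ l * (l * y + (a + y')) + (l * (x + z) + (a + z'))
    regroup = solve-∀

  -- Divided by `L * L * W ind F`, this says that the expected size of `I` is at least x/L - x/L² -
  -- 1 for x = `length F`. The subtracted terms bound the vertices of `F` that are in `I` or blocked
  -- by `I`: their expected number is at most (x + L²)/L by `W-ind-∑`.
  W-len-lower : ∀ F → hits² F F ≤ L * L →
    length F * L * W ind F ≤ L * (L * W (λ I → ind I * length I) F) + W ind F * (length F + L * L)
  W-len-lower F few = begin
    x * L * a                              ≡⟨ assoc x L a ⟩
    L * (x * a)                            ≤⟨ *-monoʳ-≤ L (W-occupancy [] F) ⟩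
    L * (L * b + W (λ I → ind I * (length I + hits² F I)) F)
      ≡⟨ cong (λ z → L * (L * b + z)) (W-cong F (λ {I} _ → cong (ind I *_) (sym (∑g I)))) ⟩
    L * (L * b + W (λ I → ind I * ∑ g I) F)        ≡⟨ *-distribˡ-+ L (L * b) _ ⟩
    L * (L * b) + L * W (λ I → ind I * ∑ g I) F    ≤⟨ +-monoʳ-≤ (L * (L * b)) (W-ind-∑ g [] F) ⟩
    L * (L * b) + a * ∑ g F                ≤⟨ +-monoʳ-≤ (L * (L * b)) (*-monoʳ-≤ a (≤-trans (≤-reflexive (∑g F)) (+-monoʳ-≤ x few))) ⟩
    L * (L * b) + a * (x + L * L)          ∎
    where
    open ≤-Reasoning
    x = length F
    a = W ind F
    b = W (λ I → ind I * length I) F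
    g : A → ℕ
    g w = 1 + ∑ (λ u → ⟦ adj u w ⟧) F
    ∑g : ∀ I → ∑ g I ≡ length I + hits² F I
    ∑g I = trans (∑-+ (λ _ → 1) _ I)
      (cong₂ _+_ (trans (∑-const 1 I) (*-identityʳ (length I))) (sym (∑-swap (λ u w → ⟦ adj u w ⟧) F I)))
    assoc : ∀ x l a → x * l * a ≡ l * (x * a)
    assoc = solve-∀

  -- `F` stands for the neighbours of a vertex v that the outside leaves free. The configurations
  -- with v weigh `L ^ length F`, those without v weigh `L * W ind F`, so the conclusion reads: K
  -- times the probability of v, plus the expected number of occupied vertices of `F`, is at least
  -- t. If `F` is small, `W ind F` is at most `2 ^ (8 * t + 4) * L ^ length F`, and v has
  -- probability at least 1/(1 + L · 2^(8t+4)).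
  local-occupancy : ∀ H .{{_ : NonZero H}} → L ≡ 2 * H → ∀ t K → t * (1 + L * 2 ^ (8 * t + 4)) ≤ K →
    ∀ F → hits² F F ≤ L * L →
    t * (L ^ length F + L * W ind F) ≤ K * L ^ length F + L * W (λ I → ind I * length I) F
  local-occupancy H L≡ t K t≤K F few with length F ≤? (8 * t + 4) * H
  ... | yes small = begin
    t * (L ^ x + L * a)                ≤⟨ *-monoʳ-≤ t (+-monoʳ-≤ (L ^ x) (*-monoʳ-≤ L a≤)) ⟩
    t * (L ^ x + L * (S * L ^ x))      ≡⟨ factor t (L ^ x) L S ⟩
    t * (1 + L * S) * L ^ x            ≤⟨ *-monoˡ-≤ (L ^ x) t≤K ⟩
    K * L ^ x                          ≤⟨ m≤m+n _ _ ⟩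
    K * L ^ x + L * b                  ∎
    where
    open ≤-Reasoning
    x = length F
    a = W ind F
    b = W (λ I → ind I * length I) F
    S = 2 ^ (8 * t + 4)
    a≤ : a ≤ S * L ^ x
    a≤ = ≤-trans (W-mono F (λ {I} _ → ind≤1 I))
      (≤-trans (≤-reflexive (W-1 F)) (suc-^≤2^ H L L≡ (8 * t + 4) x small))
    factor : ∀ t y l s → t * (y + l * (s * y)) ≡ t * (1 + l * s) * y
    factor = solve-∀
  ... | no large = ≤-trans (*-cancelˡ-≤ L {{L≢0}} (begin
    L * (t * (L ^ x + L * a))          ≤⟨ *-monoʳ-≤ L (*-monoʳ-≤ t (+-monoˡ-≤ (L * a) Lˣ≤a)) ⟩
    L * (t * (a + L * a))              ≤⟨ +-cancelʳ-≤ (a * (x + L * L)) _ _ key ⟩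
    L * (L * b)                        ∎)) (m≤n+m (L * b) (K * L ^ x))
    where
    open ≤-Reasoning
    x = length F
    a = W ind F
    b = W (λ I → ind I * length I) F
    L≢0 : NonZero L
    L≢0 = subst NonZero (sym L≡) (m*n≢0 2 H)
    1≤H : 1 ≤ H
    1≤H = >-nonZero⁻¹ H
    Lˣ≤a : L ^ x ≤ a
    Lˣ≤a = ≤-trans (≤-reflexive (sym (*-identityʳ (L ^ x)))) (W-[] ind F)
    -- Origin of the threshold `8 * t + 4`: with 1 + L ≤ 2L and L = 2H the left side is at most x +
    -- (8t + 4)H². A large x makes the second term at most xH, and x ≤ xH too, for a total of 2xH =
    -- xL.
    bound : L * (t * (1 + L)) + (x + L * L) ≤ x * L
    bound = begin
      L * (t * (1 + L)) + (x + L * L)               ≤⟨ +-monoˡ-≤ (x + L * L) (*-monoʳ-≤ L (*-monoʳ-≤ t 1+L≤)) ⟩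
      L * (t * (L + L)) + (x + L * L)               ≡⟨ cong (λ l → l * (t * (l + l)) + (x + l * l)) L≡ ⟩
      2 * H * (t * (2 * H + 2 * H)) + (x + 2 * H * (2 * H))   ≡⟨ expand H t x ⟩
      x + (8 * t + 4) * H * H                       ≤⟨ +-monoʳ-≤ x (*-monoˡ-≤ H (≰⇒≥ large)) ⟩
      x + x * H                                     ≤⟨ +-monoˡ-≤ (x * H) (≤-trans (≤-reflexive (sym (*-identityʳ x))) (*-monoʳ-≤ x 1≤H)) ⟩
      x * H + x * H                                 ≡⟨ double x H ⟩
      x * (2 * H)                                   ≡⟨ cong (x *_) L≡ ⟨
      x * L                                         ∎
      where
      expand : ∀ h t x → 2 * h * (t * (2 * h + 2 * h)) + (x + 2 * h * (2 * h)) ≡ x + (8 * t + 4) * h * h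
      expand = solve-∀
      double : ∀ x h → x * h + x * h ≡ x * (2 * h)
      double = solve-∀
      1+L≤ : 1 + L ≤ L + L
      1+L≤ = +-monoˡ-≤ L (>-nonZero⁻¹ L {{L≢0}})
    key : L * (t * (a + L * a)) + a * (x + L * L) ≤ L * (L * b) + a * (x + L * L)
    key = begin
      L * (t * (a + L * a)) + a * (x + L * L)       ≡⟨ factor L t a x ⟩
      (L * (t * (1 + L)) + (x + L * L)) * a         ≤⟨ *-monoˡ-≤ a bound ⟩
      x * L * a                                     ≤⟨ W-len-lower F few ⟩
      L * (L * b) + a * (x + L * L)                 ∎
      where
      factor : ∀ l t a x → l * (t * (a + l * a)) + a * (x + l * l) ≡ (l * (t * (1 + l)) + (x + l * l)) * a
      factor = solve-∀

  module Occupancy (H : ℕ) .{{_ : NonZero H}} (L≡ : L ≡ 2 * H) (t K : ℕ) (t≤K : t * (1 + L * 2 ^ (8 * t + 4)) ≤ K) where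

    isFree-nonneighbours : ∀ v {J} → All (λ y → adj v y ≡ false) J → isFree v J ≡ true
    isFree-nonneighbours v [] = refl
    isFree-nonneighbours v (eq ∷ eqs) rewrite eq = isFree-nonneighbours v eqs

    -- For fixed `J` outside v and its neighbours, the neighbours blocked by `J` contribute the
    -- common factor `L ^ e`, and `local-occupancy` applies to the remaining ones. This needs the
    -- edge bound for every sublist of the neighbourhood, since `J` is arbitrary.
    vertex-occupancy : ∀ v (g : A → ℕ) → K ≤ g v → (∀ {w} → adj v w ≡ true → 1 ≤ g w) →
      ∀ xs ys → All (λ x → adj v x ≡ true) xs → All (λ y → adj v y ≡ false) ys →
      (∀ {F} → F ⊆ xs → hits² F F ≤ L * L) →
      t * W ind (v ∷ xs ++ ys) ≤ W (λ I → ind I * ∑ g I) (v ∷ xs ++ ys)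
    vertex-occupancy v g K≤gv 1≤g xs ys nbrs nonnbrs few = begin
      t * W ind ((v ∷ xs) ++ ys)
        ≡⟨ cong (t *_) (W-++ ind (v ∷ xs) ys) ⟩
      t * W (λ J → W (λ I → ind (I ++ J)) (v ∷ xs)) ys
        ≡⟨ W-* t _ ys ⟨
      W (λ J → t * W (λ I → ind (I ++ J)) (v ∷ xs)) ys
        ≤⟨ W-mono ys fibre ⟩
      W (λ J → W (λ I → ind (I ++ J) * ∑ g (I ++ J)) (v ∷ xs)) ys
        ≡⟨ W-++ (λ I → ind I * ∑ g I) (v ∷ xs) ys ⟨
      W (λ I → ind I * ∑ g I) ((v ∷ xs) ++ ys) ∎
      where
      open ≤-Reasoning
      length≤∑g : ∀ {I} J → All (λ x → adj v x ≡ true) I → length I ≤ ∑ g (I ++ J)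
      length≤∑g J [] = z≤n
      length≤∑g J (eq ∷ eqs) = +-mono-≤ (1≤g eq) (length≤∑g J eqs)
      fibre : ∀ {J} → J ⊆ ys → t * W (λ I → ind (I ++ J)) (v ∷ xs) ≤ W (λ I → ind (I ++ J) * ∑ g (I ++ J)) (v ∷ xs)
      fibre {J} J⊆ with W-restrict (λ x → isFree x J) xs
      ... | F , e , F⊆ , len , W≡ = begin
        t * (L * W (λ I → ind (I ++ J)) xs + Q)
          ≡⟨ cong₂ (λ a b → t * (L * a + b)) W₁ Q≡ ⟩
        t * (L * (E * W ind F * ind J) + E * Y * ind J)
          ≡⟨ factor₁ t L E (W ind F) (ind J) Y ⟩
        E * ind J * (t * (Y + L * W ind F))
          ≤⟨ *-monoʳ-≤ (E * ind J) (local-occupancy H L≡ t K t≤K F (few F⊆)) ⟩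
        E * ind J * (K * Y + L * W (λ I → ind I * length I) F)
          ≡⟨ factor₂ K L E (W (λ I → ind I * length I) F) (ind J) Y ⟩
        L * (E * W (λ I → ind I * length I) F * ind J) + E * Y * ind J * K
          ≡⟨ cong₂ (λ a b → L * a + b * K) W₂ Q≡ ⟨
        L * W (λ I → ind (I ++ J) * length I) xs + Q * K
          ≡⟨ cong (L * W (λ I → ind (I ++ J) * length I) xs +_) (W-*ʳ K _ xs) ⟨
        L * W (λ I → ind (I ++ J) * length I) xs + W (λ I → ind (v ∷ I ++ J) * K) xs
          ≤⟨ +-mono-≤ (*-monoʳ-≤ L (W-mono xs (λ {I} I⊆ → *-monoʳ-≤ (ind (I ++ J)) (length≤∑g J (Subₚ.All-resp-⊆ I⊆ nbrs)))))
               (W-mono xs (λ {I} _ → *-monoʳ-≤ (ind (v ∷ I ++ J)) (≤-trans K≤gv (m≤m+n (g v) _)))) ⟩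
        L * W (λ I → ind (I ++ J) * ∑ g (I ++ J)) xs + W (λ I → ind (v ∷ I ++ J) * ∑ g (v ∷ I ++ J)) xs ∎
        where
        E = L ^ e
        Y = L ^ length F
        Q = W (λ I → ind (v ∷ I ++ J)) xs
        W₁ : W (λ I → ind (I ++ J)) xs ≡ E * W ind F * ind J
        W₁ = trans (W-cong xs (λ {I} _ → ind-++ I J)) (trans (W-*ʳ (ind J) _ xs) (cong (_* ind J) (W≡ ind)))
        W₂ : W (λ I → ind (I ++ J) * length I) xs ≡ E * W (λ I → ind I * length I) F * ind J
        W₂ = trans (W-cong xs (λ {I} _ → trans (cong (_* length I) (ind-++ I J))
                      (reorder (∏ (λ x → isFree x J) I) (ind I) (ind J) (length I))))
               (trans (W-*ʳ (ind J) _ xs) (cong (_* ind J) (W≡ (λ I → ind I * length I))))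
          where
          reorder : ∀ a b c e → a * b * c * e ≡ a * (b * e) * c
          reorder = solve-∀
        Q≡ : Q ≡ E * Y * ind J
        -- Occupying v keeps all of `xs` out, and no vertex of `J` is a neighbour of v.
        Q≡ = trans (W-only-[] (λ I → ind (v ∷ I ++ J)) xs vanish)
          (cong₂ _*_ (trans (cong (L ^_) len) (^-distribˡ-+-* L e (length F)))
            (trans (cong (λ b → ⟦ b ⟧ * ind J) (isFree-nonneighbours v (Subₚ.All-resp-⊆ J⊆ nonnbrs))) (+-identityʳ (ind J))))
          where
          vanish : ∀ {x I} → x ∷ I ⊆ xs → ind (v ∷ x ∷ I ++ J) ≡ 0
          vanish s with eq ∷ _ ← Subₚ.All-resp-⊆ s nbrs rewrite eq = refl
        factor₁ : ∀ t l e a i y → t * (l * (e * a * i) + e * y * i) ≡ e * i * (t * (y + l * a))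
        factor₁ = solve-∀
        factor₂ : ∀ k l e b i y → e * i * (k * y + l * b) ≡ l * (e * b * i) + e * y * i * k
        factor₂ = solve-∀

  -- From local occupancy to a large independent set

  split-neighbours : ∀ v zs → ∃[ xs ] ∃[ ys ] (zs ↭ xs ++ ys × xs ⊆ zs ×
    All (λ x → adj v x ≡ true) xs × All (λ y → adj v y ≡ false) ys)
  split-neighbours v [] = [] , [] , ↭-refl , [] , [] , []
  split-neighbours v (z ∷ zs) with split-neighbours v zs | adj v z in eq
  ... | xs , ys , p , s , nbrs , nonnbrs | true = z ∷ xs , ys , prep z p , refl ∷ s , eq ∷ nbrs , nonnbrs
  ... | xs , ys , p , s , nbrs , nonnbrs | false =
    xs , z ∷ ys , ↭-trans (prep z p) (↭-sym (shift z xs ys)) , z ∷ʳ s , nbrs , eq ∷ nonnbrs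

  -- Exhaustive search makes averaging constructive: a witness is found, or all sublists are refuted
  -- and the expectations contradict each other.
  search : ∀ {P : List A → Set} → (∀ I → Dec (P I)) → ∀ xs → (∃[ I ] (I ⊆ xs × P I)) ⊎ (∀ {I} → I ⊆ xs → ¬ P I)
  search P? [] with P? []
  ... | yes p = inj₁ ([] , [] , p)
  ... | no ¬p = inj₂ λ { [] → ¬p }
  search P? (x ∷ xs) with search P? xs | search (λ I → P? (x ∷ I)) xs
  ... | inj₁ (I , s , p) | _ = inj₁ (I , x ∷ʳ s , p)
  ... | inj₂ _ | inj₁ (I , s , p) = inj₁ (x ∷ I , refl ∷ s , p)
  ... | inj₂ no₁ | inj₂ no₂ = inj₂ λ { (_ ∷ʳ s) → no₁ s ; (refl ∷ s) → no₂ s }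

  isFree⇒All : ∀ x I → isFree x I ≡ true → All (λ y → adj x y ≡ false) I
  isFree⇒All x [] _ = []
  isFree⇒All x (y ∷ I) eq with adj x y in xy
  ... | false = xy ∷ isFree⇒All x I eq

  ind⇒AllPairs : ∀ I → 1 ≤ ind I → AllPairs (λ x y → adj x y ≡ false) I
  ind⇒AllPairs [] _ = []
  ind⇒AllPairs (x ∷ I) pos with isFree x I in eq
  ... | true = isFree⇒All x I eq ∷ ind⇒AllPairs I (subst (1 ≤_) (+-identityʳ (ind I)) pos)

  count≤1 : (_≟_ : DecidableEquality A) → ∀ w {V} → Unique V → ∑ (λ v → ⟦ ⌊ v ≟ w ⌋ ⟧) V ≤ 1
  count≤1 _≟_ w [] = z≤n
  count≤1 _≟_ w (_∷_ {v} {V} v∉ uniq) with v ≟ w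
  ... | no _ = count≤1 _≟_ w uniq
  ... | yes refl = s≤s (≤-reflexive (absent v∉))
    where
    absent : ∀ {V} → All (v ≢_) V → ∑ (λ u → ⟦ ⌊ u ≟ v ⌋ ⟧) V ≡ 0
    absent [] = refl
    absent (_∷_ {u} v≢u rest) with u ≟ v
    ... | yes u≡v = ⊥-elim (v≢u (sym u≡v))
    ... | no _ = absent rest

  -- Double counting of the charges `g v w`. Each v receives at least t in expectation, whereas an
  -- occupied w gives K to itself and 1 to each of at most Δ adjacent vertices.
  large-independent-set : (_≟_ : DecidableEquality A) → ∀ H .{{_ : NonZero H}} → L ≡ 2 * H →
    ∀ t K Δ → t * (1 + L * 2 ^ (8 * t + 4)) ≤ K →
    ∀ V → Unique V → (∀ {w} → w ∈ V → ∑ (λ v → ⟦ adj v w ⟧) V ≤ Δ) →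
    (∀ {v} → v ∈ V → ∀ {F} → F ⊆ V → All (λ x → adj v x ≡ true) F → hits² F F ≤ L * L) →
    ∃[ I ] (I ⊆ V × AllPairs (λ x y → adj x y ≡ false) I × length V * t ≤ (K + Δ) * length I)
  large-independent-set _≟_ H L≡ t K Δ t≤K V uniq degree≤ few
    with search (λ I → (1 ≤? ind I) ×-dec (length V * t ≤? (K + Δ) * length I)) V
  ... | inj₁ (I , s , pos , large) = I , s , ind⇒AllPairs I pos , large
  ... | inj₂ none = ⊥-elim (<-irrefl refl (begin-strict
    W (λ I → ind I * (D * length I)) V
      <⟨ m<n+m _ W-ind>0 ⟩
    W ind V + W (λ I → ind I * (D * length I)) V
      ≡⟨ W-+ ind (λ I → ind I * (D * length I)) V ⟨
    W (λ I → ind I + ind I * (D * length I)) V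
      ≤⟨ W-mono V deficient ⟩
    W (λ I → ind I * (length V * t)) V
      ≡⟨ W-*ʳ (length V * t) ind V ⟩
    W ind V * (length V * t)
      ≡⟨ rotate (W ind V) (length V) t ⟩
    length V * (t * W ind V)
      ≡⟨ ∑-const (t * W ind V) V ⟨
    ∑ (λ _ → t * W ind V) V
      ≤⟨ ∑-mono V vertex ⟩
    ∑ (λ v → W (λ I → ind I * ∑ (g v) I) V) V
      ≡⟨ W-∑ (λ v I → ind I * ∑ (g v) I) V V ⟨
    W (λ I → ∑ (λ v → ind I * ∑ (g v) I) V) V
      ≡⟨ W-cong V (λ {I} _ → ∑-* (ind I) (λ v → ∑ (g v) I) V) ⟩
    W (λ I → ind I * ∑ (λ v → ∑ (g v) I) V) V
      ≤⟨ W-mono V (λ {I} s → *-monoʳ-≤ (ind I) (columns s)) ⟩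
    W (λ I → ind I * (D * length I)) V ∎))
    where
    open ≤-Reasoning
    instance _ = subst NonZero (sym L≡) (m*n≢0 2 H)
    D = K + Δ
    g : A → A → ℕ
    g v w = K * ⟦ ⌊ v ≟ w ⌋ ⟧ + ⟦ adj v w ⟧
    W-ind>0 : 1 ≤ W ind V
    W-ind>0 = ≤-trans (≤-trans (m^n>0 L (length V)) (≤-reflexive (sym (*-identityʳ _)))) (W-[] ind V)
    rotate : ∀ a b c → a * (b * c) ≡ b * (c * a)
    rotate = solve-∀
    -- A failed inequality between natural numbers fails by at least 1. The additional `ind I`
    -- yields the strict inequality after summation, because `W ind V` is positive.
    deficient : ∀ {I} → I ⊆ V → ind I + ind I * (D * length I) ≤ ind I * (length V * t)
    deficient {I} s with 1 ≤? ind I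
    ... | yes pos = ≤-trans (≤-reflexive (sym (*-suc (ind I) (D * length I))))
                      (*-monoʳ-≤ (ind I) (≰⇒> (λ large → none s (pos , large))))
    ... | no ¬pos rewrite n<1⇒n≡0 (≰⇒> ¬pos) = z≤n
    columns : ∀ {I} → I ⊆ V → ∑ (λ v → ∑ (g v) I) V ≤ D * length I
    columns {I} s = begin
      ∑ (λ v → ∑ (g v) I) V                   ≡⟨ ∑-swap g V I ⟩
      ∑ (λ w → ∑ (λ v → g v w) V) I           ≤⟨ ∑-mono I column ⟩
      ∑ (λ _ → D) I                           ≡⟨ trans (∑-const D I) (*-comm (length I) D) ⟩
      D * length I                            ∎
      where
      column : ∀ {w} → w ∈ I → ∑ (λ v → g v w) V ≤ D
      column {w} w∈ = begin
        ∑ (λ v → g v w) V                                              ≡⟨ ∑-+ _ (λ v → ⟦ adj v w ⟧) V ⟩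
        ∑ (λ v → K * ⟦ ⌊ v ≟ w ⌋ ⟧) V + ∑ (λ v → ⟦ adj v w ⟧) V        ≡⟨ cong (_+ ∑ (λ v → ⟦ adj v w ⟧) V) (∑-* K _ V) ⟩
        K * ∑ (λ v → ⟦ ⌊ v ≟ w ⌋ ⟧) V + ∑ (λ v → ⟦ adj v w ⟧) V        ≤⟨ +-mono-≤ (*-monoʳ-≤ K (count≤1 _≟_ w uniq)) (degree≤ (Subₚ.Any-resp-⊆ s w∈)) ⟩
        K * 1 + Δ                                                      ≡⟨ cong (_+ Δ) (*-identityʳ K) ⟩
        D                                                              ∎
    ind∑g-↭ : ∀ v {I J} → I ↭ J → ind I * ∑ (g v) I ≡ ind J * ∑ (g v) J
    ind∑g-↭ v p = cong₂ _*_ (ind-↭ p) (∑-↭ (g v) p)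
    vertex : ∀ {v} → v ∈ V → t * W ind V ≤ W (λ I → ind I * ∑ (g v) I) V
    vertex {v} v∈ with as , bs , V≡ ← ∈-∃++ v∈ with xs , ys , p , xs⊆ , nbrs , nonnbrs ← split-neighbours v (as ++ bs) = begin
      t * W ind V                     ≡⟨ cong (t *_) (W-↭ ind ind-↭ V↭) ⟩
      t * W ind (v ∷ xs ++ ys)        ≤⟨ Occupancy.vertex-occupancy H L≡ t K t≤K v (g v) K≤g (λ {w} → 1≤g w) xs ys nbrs nonnbrs
                                           (λ s → few v∈ (⊆-trans s xs⊆V) (Subₚ.All-resp-⊆ s nbrs)) ⟩
      W (λ I → ind I * ∑ (g v) I) (v ∷ xs ++ ys)   ≡⟨ W-↭ _ (ind∑g-↭ v) V↭ ⟨
      W (λ I → ind I * ∑ (g v) I) V   ∎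
      where
      V↭ : V ↭ v ∷ xs ++ ys
      V↭ = subst (_↭ v ∷ xs ++ ys) (sym V≡) (↭-trans (shift v as bs) (prep v p))
      xs⊆V : xs ⊆ V
      xs⊆V = subst (xs ⊆_) (sym V≡) (⊆-trans xs⊆ (Subₚ.++⁺ (⊆-refl {x = as}) (v ∷ʳ ⊆-refl)))
      K≤g : K ≤ g v v
      K≤g with v ≟ v
      ... | yes _ = ≤-trans (≤-reflexive (sym (*-identityʳ K))) (m≤m+n _ _)
      ... | no v≢v = ⊥-elim (v≢v refl)
      1≤g : ∀ w → adj v w ≡ true → 1 ≤ g v w
      1≤g w eq rewrite eq = m≤n+m 1 _

-- Alignments of words

-- The index is the exact number of insertions and deletions of this particular alignment, not the
-- least possible one: the parity arguments follow one alignment letter by letter.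
data Edits : ℕ → Word → Word → Set where
  []   : Edits 0 [] []
  keep : ∀ {m u v} x → Edits m u v → Edits m (x ∷ u) (x ∷ v)
  del  : ∀ {m u v} x → Edits m u v → Edits (suc m) (x ∷ u) v
  ins  : ∀ {m u v} y → Edits m u v → Edits (suc m) u (y ∷ v)

edits? : ∀ m u v → Dec (Edits m u v)
edits? zero [] [] = yes []
edits? (suc m) [] [] = no λ ()
edits? zero [] (y ∷ v) = no λ ()
edits? (suc m) [] (y ∷ v) = map′ (ins y) (λ { (ins _ e) → e }) (edits? m [] v)
edits? zero (x ∷ u) [] = no λ ()
edits? (suc m) (x ∷ u) [] = map′ (del x) (λ { (del _ e) → e }) (edits? m u [])
edits? zero (x ∷ u) (y ∷ v) with x Boolₚ.≟ y
... | yes refl = map′ (keep x) (λ { (keep _ e) → e }) (edits? zero u v)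
... | no x≢y = no λ { (keep _ _) → x≢y refl }
edits? (suc m) (x ∷ u) (y ∷ v) with edits? m u (y ∷ v) | edits? m (x ∷ u) v | x Boolₚ.≟ y
... | yes e | _ | _ = yes (del x e)
... | no _ | yes e | _ = yes (ins y e)
... | no ¬del | no ¬ins | no x≢y = no λ { (keep _ _) → x≢y refl ; (del _ e) → ¬del e ; (ins _ e) → ¬ins e }
... | no ¬del | no ¬ins | yes refl =
  map′ (keep x) (λ { (keep _ e) → e ; (del _ e) → ⊥-elim (¬del e) ; (ins _ e) → ⊥-elim (¬ins e) }) (edits? (suc m) u v)

edits-sym : ∀ {m u v} → Edits m u v → Edits m v u
edits-sym [] = []
edits-sym (keep x e) = keep x (edits-sym e)
edits-sym (del x e) = ins x (edits-sym e)
edits-sym (ins y e) = del y (edits-sym e)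

edits-zero : ∀ {u v} → Edits 0 u v → u ≡ v
edits-zero [] = refl
edits-zero (keep x e) = cong (x ∷_) (edits-zero e)

edits-++ : ∀ {m n u₁ u₂ v₁ v₂} → Edits m u₁ v₁ → Edits n u₂ v₂ → Edits (m + n) (u₁ ++ u₂) (v₁ ++ v₂)
edits-++ [] f = f
edits-++ (keep x e) f = keep x (edits-++ e f)
edits-++ (del x e) f = del x (edits-++ e f)
edits-++ (ins y e) f = ins y (edits-++ e f)

edits-split : ∀ u₁ {u₂ m v} → Edits m (u₁ ++ u₂) v → ∃[ m₁ ] ∃[ m₂ ] ∃[ v₁ ] ∃[ v₂ ]
  (m ≡ m₁ + m₂ × v ≡ v₁ ++ v₂ × Edits m₁ u₁ v₁ × Edits m₂ u₂ v₂)
edits-split [] {v = v} e = 0 , _ , [] , v , refl , refl , [] , e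
edits-split (x ∷ u₁) (keep x e) with _ , _ , _ , _ , refl , refl , e₁ , e₂ ← edits-split u₁ e =
  _ , _ , _ , _ , refl , refl , keep x e₁ , e₂
edits-split (x ∷ u₁) (del x e) with _ , _ , _ , _ , refl , refl , e₁ , e₂ ← edits-split u₁ e =
  _ , _ , _ , _ , refl , refl , del x e₁ , e₂
edits-split (x ∷ u₁) (ins y e) with _ , _ , _ , _ , refl , refl , e₁ , e₂ ← edits-split (x ∷ u₁) e =
  _ , _ , _ , _ , refl , refl , ins y e₁ , e₂

-- The letters of u outside w are deleted and those of v outside w are inserted.
edits-lcs : ∀ {w u v : Word} → w ⊆ u → w ⊆ v → ∃[ m ] (Edits m u v × m + 2 * length w ≡ length u + length v)
edits-lcs [] [] = 0 , [] , refl
edits-lcs (y ∷ʳ s) t with m , e , eq ← edits-lcs s t = suc m , del y e , cong suc eq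
edits-lcs {u = u} [] (_∷ʳ_ {ys = v} y t) with m , e , eq ← edits-lcs [] t =
  suc m , ins y e , cong suc eq
edits-lcs {w} {u} s@(_ ∷ _) (_∷ʳ_ {ys = v} y t) with m , e , eq ← edits-lcs s t =
  suc m , ins y e , trans (cong suc eq) (sym (+-suc (length u) (length v)))
edits-lcs {_ ∷ w} {_ ∷ u} {_ ∷ v} (refl ∷ s) (refl ∷ t) with m , e , eq ← edits-lcs s t =
  m , keep _ e , trans (shuffle m (length w)) (trans (cong (2 +_) eq) (cong suc (sym (+-suc (length u) (length v)))))
  where
  shuffle : ∀ m w → m + 2 * (1 + w) ≡ 2 + (m + 2 * w)
  shuffle = solve-∀

-- Parities and offsets

odd : ℕ → Bool
odd zero = false
odd (suc n) = not (odd n)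

odd-+ : ∀ m n → odd (m + n) ≡ odd m xor odd n
odd-+ zero n = refl
odd-+ (suc m) n rewrite odd-+ m n with odd m | odd n
... | true | true = refl
... | true | false = refl
... | false | true = refl
... | false | false = refl

odd-double : ∀ a → odd (a + a) ≡ false
odd-double a rewrite odd-+ a a = Boolₚ.xor-same (odd a)

odd⇒1≤ : ∀ {n} → odd n ≡ true → 1 ≤ n
odd⇒1≤ {suc n} _ = s≤s z≤n

-- The difference q - p equals a - b with a + b = s, so its absolute value is at most s and its
-- parity is that of s. For the lengths of two aligned words, a counts insertions and b deletions.
Apart : ℕ → ℕ → ℕ → Set
Apart s p q = ∃[ a ] ∃[ b ] (a + b ≡ s × p + a ≡ q + b)

apart-sym : ∀ {s p q} → Apart s p q → Apart s q p
apart-sym (a , b , ab , eq) = b , a , trans (+-comm b a) ab , sym eq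

apart-trans : ∀ {s t p q r} → Apart s p q → Apart t q r → Apart (s + t) p r
apart-trans {p = p} {q} {r} (a , b , refl , eq) (c , e , refl , eq') =
  a + c , b + e , interchange a c b e ,
  (begin
    p + (a + c)    ≡⟨ +-assoc p a c ⟨
    p + a + c      ≡⟨ cong (_+ c) eq ⟩
    q + b + c      ≡⟨ exchange q b c ⟩
    q + c + b      ≡⟨ cong (_+ b) eq' ⟩
    r + e + b      ≡⟨ trans (+-assoc r e b) (cong (r +_) (+-comm e b)) ⟩
    r + (b + e)    ∎)
  where
  open ≡-Reasoning
  interchange : ∀ a c b e → a + c + (b + e) ≡ a + b + (c + e)
  interchange = solve-∀
  exchange : ∀ q b c → q + b + c ≡ q + c + b
  exchange = solve-∀

apart-+ : ∀ {s t p q p' q'} → Apart s p q → Apart t p' q' → Apart (s + t) (p + p') (q + q')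
apart-+ {p = p} {q} {p'} {q'} (a , b , refl , eq) (c , e , refl , eq') =
  a + c , b + e , interchange a c b e ,
  trans (interchange p p' a c) (trans (cong₂ _+_ eq eq') (interchange q b q' e))
  where
  interchange : ∀ a c b e → a + c + (b + e) ≡ a + b + (c + e)
  interchange = solve-∀

apart-≡⇒even : ∀ {s p} → Apart s p p → odd s ≡ false
apart-≡⇒even {p = p} (a , b , refl , eq) rewrite +-cancelˡ-≡ p a b eq = odd-double b

apart-≤ : ∀ {s p q} → Apart s p q → p ≤ q + s
apart-≤ {p = p} {q} (a , b , refl , eq) = begin
  p              ≤⟨ m≤m+n p a ⟩
  p + a          ≡⟨ eq ⟩
  q + b          ≤⟨ +-monoʳ-≤ q (m≤n+m b a) ⟩
  q + (a + b)    ∎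
  where open ≤-Reasoning

edits-apart : ∀ {m u v} → Edits m u v → Apart m (length u) (length v)
edits-apart [] = 0 , 0 , refl , refl
edits-apart (keep x e) with a , b , ab , eq ← edits-apart e = a , b , ab , cong suc eq
edits-apart {v = v} (del x e) with a , b , ab , eq ← edits-apart e =
  a , suc b , trans (+-suc a b) (cong suc ab) , trans (cong suc eq) (sym (+-suc (length v) b))
edits-apart {u = u} (ins y e) with a , b , ab , eq ← edits-apart e =
  suc a , b , cong suc ab , trans (+-suc (length u) a) (cong suc eq)

-- Occurrences of aperiodic words

++-prefix : ∀ (p p' : Word) {s s'} → p ++ s ≡ p' ++ s' → length p ≤ length p' →
  ∃[ x ] (p' ≡ p ++ x × s ≡ x ++ s')
++-prefix [] p' eq _ = p' , refl , eq
++-prefix (a ∷ p) (b ∷ p') eq (s≤s le) with refl ← ∷-injectiveˡ eq | x , refl , eq' ← ++-prefix p p' (∷-injectiveʳ eq) le =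
  x , refl , eq'

-- No period of length at most r: u is not a prefix of x ++ x ++ x ++ ⋯ when 1 ≤ length x ≤ r.
Aperiodic : ℕ → Word → Set
Aperiodic r u = ∀ x z → 1 ≤ length x → length x ≤ r → x ++ u ≢ u ++ z

-- Let x be the piece between the two starting points. Both occurrences lie in the same word, so u
-- is a prefix of `x ++ u`, which makes the length of x a period.
aperiodic-occurrence-< : ∀ {r u} → Aperiodic r u → ∀ p p' {s s'} → p ++ u ++ s ≡ p' ++ u ++ s' →
  length p < length p' → length p' ≤ length p + r → ⊥
aperiodic-occurrence-< {r} {u} ap p p' {s} {s'} eq lt le
  with x , refl , eq₁ ← ++-prefix p p' eq (<⇒≤ lt)
  with z , eq₂ , _ ← ++-prefix u (x ++ u) (trans eq₁ (sym (++-assoc x u s')))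
                       (subst (length u ≤_) (sym (length-++ x)) (m≤n+m (length u) (length x)))
  = ap x z (+-cancelˡ-≤ (length p) 1 (length x) (subst₂ _≤_ (sym (+-comm (length p) 1)) (length-++ p) lt))
           (+-cancelˡ-≤ (length p) (length x) r (subst (_≤ length p + r) (length-++ p) le)) eq₂

-- The two occurrences must coincide, and only an even number of unit shifts adds up to zero.
aperiodic-occurrence : ∀ {r u} → Aperiodic r u → ∀ {k} p p' {s s'} → p ++ u ++ s ≡ p' ++ u ++ s' →
  Apart k (length p) (length p') → k ≤ r → odd k ≡ false
aperiodic-occurrence ap {k} p p' eq apart k≤r with <-cmp (length p) (length p')
... | tri< lt _ _ = ⊥-elim (aperiodic-occurrence-< ap p p' eq lt
        (≤-trans (apart-≤ (apart-sym apart)) (+-monoʳ-≤ (length p) k≤r)))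
... | tri≈ _ len≡ _ = apart-≡⇒even (subst (Apart k (length p)) (sym len≡) apart)
... | tri> _ _ gt = ⊥-elim (aperiodic-occurrence-< ap p' p (sym eq) gt
        (≤-trans (apart-≤ apart) (+-monoʳ-≤ (length p') k≤r)))

-- The empty default lets the last block have a window too, with an empty successor, and gives the
-- insertions after it a block to belong to.
headBlock : List Word → Word
headBlock [] = []
headBlock (u ∷ us) = u

tailBlocks : List Word → List Word
tailBlocks [] = []
tailBlocks (u ∷ us) = us

-- Middle parts are two consecutive blocks; the final empty window receives the insertions after the last block.
windows : List Word → List (Word × Word × Word)
windows [] = ([] , [] , []) ∷ []
windows (u ∷ us) = ([] , u ++ headBlock us , concat (tailBlocks us)) ∷ map (λ (a , b , c) → u ++ a , b , c) (windows us)

record Collision (us : List Word) (v w : Word) (m n : ℕ) : Set where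
  constructor collision
  field
    {U₁ U₂ U₃} : Word
    {V₁ V₂ V₃ W₁ W₂ W₃} : Word
    {p₁ p₂ p₃ q₁ q₂ q₃} : ℕ
    window : (U₁ , U₂ , U₃) ∈ windows us
    m≡ : m ≡ p₁ + (p₂ + p₃)
    n≡ : n ≡ q₁ + (q₂ + q₃)
    v≡ : v ≡ V₁ ++ V₂ ++ V₃
    w≡ : w ≡ W₁ ++ W₂ ++ W₃
    ev₁ : Edits p₁ U₁ V₁
    ev₂ : Edits p₂ U₂ V₂
    ev₃ : Edits p₃ U₃ V₃
    ew₁ : Edits q₁ U₁ W₁
    ew₂ : Edits q₂ U₂ W₂
    ew₃ : Edits q₃ U₃ W₃
    2≤ : 2 ≤ p₂ + q₂

-- `k = 0` is a mere cut behind the first block. `k = 1` records an edit in that block, which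
-- collides with an edit in the block before it.
record HeadEdits (k : ℕ) (us : List Word) (v w : Word) (m n : ℕ) : Set where
  constructor headEdits
  field
    {V₁ V₂ W₁ W₂} : Word
    {p₁ p₂ q₁ q₂} : ℕ
    m≡ : m ≡ p₁ + p₂
    n≡ : n ≡ q₁ + q₂
    v≡ : v ≡ V₁ ++ V₂
    w≡ : w ≡ W₁ ++ W₂
    ev₁ : Edits p₁ (headBlock us) V₁
    ev₂ : Edits p₂ (concat (tailBlocks us)) V₂
    ew₁ : Edits q₁ (headBlock us) W₁
    ew₂ : Edits q₂ (concat (tailBlocks us)) W₂
    k≤ : k ≤ p₁ + q₁

head-split : ∀ us {v m} → Edits m (concat us) v → ∃[ p ] ∃[ q ] ∃[ v₁ ] ∃[ v₂ ]
  (m ≡ p + q × v ≡ v₁ ++ v₂ × Edits p (headBlock us) v₁ × Edits q (concat (tailBlocks us)) v₂)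
head-split [] {v} {m} e = m , 0 , v , [] , sym (+-identityʳ m) , sym (++-identityʳ v) , e , []
head-split (u ∷ us) e = edits-split u e

head-edits : ∀ us {v w m n} → Edits m (concat us) v → Edits n (concat us) w → HeadEdits 0 us v w m n
head-edits us e f
  with _ , _ , _ , _ , m≡ , v≡ , e₁ , e₂ ← head-split us e
     | _ , _ , _ , _ , n≡ , w≡ , f₁ , f₂ ← head-split us f
  = headEdits m≡ n≡ v≡ w≡ e₁ e₂ f₁ f₂ z≤n

collision-here : ∀ {k u us v₁ v₂ w₁ w₂ c₁ c₂ n₁ n₂} → Edits c₁ u v₁ → Edits c₂ u w₁ →
  HeadEdits k us v₂ w₂ n₁ n₂ → 2 ≤ c₁ + c₂ + k →
  Collision (u ∷ us) (v₁ ++ v₂) (w₁ ++ w₂) (c₁ + n₁) (c₂ + n₂)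
collision-here {k} {v₁ = v₁} {w₁ = w₁} {c₁ = c₁} {c₂} e f (headEdits {V₁} {V₂} {W₁} {W₂} {p₁} {p₂} {q₁} {q₂} refl refl refl refl e₁ e₂ f₁ f₂ k≤) 2≤ =
  collision (here refl) (sym (+-assoc c₁ p₁ p₂)) (sym (+-assoc c₂ q₁ q₂)) (sym (++-assoc v₁ V₁ V₂)) (sym (++-assoc w₁ W₁ W₂))
    [] (edits-++ e e₁) e₂ [] (edits-++ f f₁) f₂
    (≤-trans 2≤ (≤-trans (+-monoʳ-≤ (c₁ + c₂) k≤) (≤-reflexive (interchange c₁ c₂ p₁ q₁))))
  where
  interchange : ∀ a b c e → a + b + (c + e) ≡ a + c + (b + e)
  interchange = solve-∀

collision-there : ∀ {u us v₁ v₂ w₁ w₂ c₁ c₂ n₁ n₂} → Edits c₁ u v₁ → Edits c₂ u w₁ →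
  Collision us v₂ w₂ n₁ n₂ → Collision (u ∷ us) (v₁ ++ v₂) (w₁ ++ w₂) (c₁ + n₁) (c₂ + n₂)
collision-there {v₁ = v₁} {w₁ = w₁} {c₁ = c₁} {c₂} e f
  (collision {V₁ = V₁} {V₂} {V₃} {W₁} {W₂} {W₃} {p₁} {p₂} {p₃} {q₁} {q₂} {q₃} i refl refl refl refl e₁ e₂ e₃ f₁ f₂ f₃ 2≤) =
  collision (there (∈-map⁺ _ i)) (sym (+-assoc c₁ p₁ _)) (sym (+-assoc c₂ q₁ _))
    (sym (++-assoc v₁ V₁ _)) (sym (++-assoc w₁ W₁ _))
    (edits-++ e e₁) e₂ e₃ (edits-++ f f₁) f₂ f₃ 2≤

-- The remaining blocks us of the base word, the corresponding suffixes v, w of two of its neighbours, and the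
-- suffix w' of the second neighbour that is aligned with v; s edits have been used so far, by the three alignments together.
record State (r : ℕ) (us : List Word) (s m₁ m₂ m₃ : ℕ) (v w : Word) : Set where
  constructor state
  field
    {pre pre' w'} : Word
    apart : Apart s (length pre) (length pre')
    bound : s + (m₁ + m₂ + m₃) ≤ r
    e₁ : Edits m₁ (concat us) v
    e₂ : Edits m₂ (concat us) w
    e₃ : Edits m₃ v w'
    same : pre ++ w ≡ pre' ++ w'

record Step (r : ℕ) (u : Word) (us : List Word) (s m₁ m₂ m₃ : ℕ) (v w : Word) : Set where
  constructor step
  field
    {c₁ c₂ c₃ n₁ n₂ n₃} : ℕ
    {v₁ v₂ w₁ w₂} : Word
    m₁≡ : m₁ ≡ c₁ + n₁
    m₂≡ : m₂ ≡ c₂ + n₂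
    m₃≡ : m₃ ≡ c₃ + n₃
    v≡ : v ≡ v₁ ++ v₂
    w≡ : w ≡ w₁ ++ w₂
    e₁ : Edits c₁ u v₁
    e₂ : Edits c₂ u w₁
    rest : State r us (s + (c₁ + c₂ + c₃)) n₁ n₂ n₃ v₂ w₂
    unclean : odd s ≡ true → c₁ + c₂ + c₃ ≢ 0

-- The change of offset across a block is read off the alignments composed as w₁, u, v₁, w₁', so its
-- size and parity are governed by the edits of all three.
state-step : ∀ {r u us s m₁ m₂ m₃ v w} → Aperiodic r u → State r (u ∷ us) s m₁ m₂ m₃ v w → Step r u us s m₁ m₂ m₃ v w
state-step {r} {u} {us} {s} ap (state {pre} {pre'} apart bound e₁ e₂ e₃ same)
  with c₁ , n₁ , v₁ , v₂ , refl , refl , e₁₁ , e₁₂ ← edits-split u e₁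
     | c₂ , n₂ , w₁ , w₂ , refl , refl , e₂₁ , e₂₂ ← edits-split u e₂
  with c₃ , n₃ , w₁' , w₂' , refl , refl , e₃₁ , e₃₂ ← edits-split v₁ e₃
  = step refl refl refl refl refl e₁₁ e₂₁
      (state {pre = pre ++ w₁} {pre' = pre' ++ w₁'}
        (subst₂ (Apart _) (sym (length-++ pre)) (sym (length-++ pre'))
          (apart-+ apart (subst (λ c → Apart c (length w₁) (length w₁')) (rotate c₁ c₂ c₃)
            (apart-trans (apart-sym (edits-apart e₂₁)) (apart-trans (edits-apart e₁₁) (edits-apart e₃₁))))))
        (subst (_≤ r) (regroup s c₁ c₂ c₃ n₁ n₂ n₃) bound)
        e₁₂ e₂₂ e₃₂
        (trans (++-assoc pre w₁ w₂) (trans same (sym (++-assoc pre' w₁' w₂')))))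
      (unclean c₁ c₂ c₃ e₁₁ e₂₁ e₃₁)
  where
  rotate : ∀ a b c → b + (a + c) ≡ a + b + c
  rotate = solve-∀
  regroup : ∀ s a b c a' b' c' → s + (a + a' + (b + b') + (c + c')) ≡ s + (a + b + c) + (a' + b' + c')
  regroup = solve-∀
  unclean : ∀ c₁ c₂ c₃ → Edits c₁ u v₁ → Edits c₂ u w₁ → Edits c₃ v₁ w₁' → odd s ≡ true → c₁ + c₂ + c₃ ≢ 0
  -- Without edits, `u` itself occurs in the second neighbour behind both `pre` and `pre'`, at
  -- positions at most s ≤ r apart.
  unclean zero zero zero f₁ f₂ f₃ odd-s _
    with refl ← edits-zero f₁ | refl ← edits-zero f₂
    with refl ← edits-zero f₃
    with () ← trans (sym odd-s) (aperiodic-occurrence ap pre pre' same apart (≤-trans (m≤m+n s _) bound))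

-- At the end both routes have read the whole second neighbour, hence the final offset is zero.
state-even : ∀ {r s m₁ m₂ m₃ v w} → State r [] s m₁ m₂ m₃ v w → odd (s + (m₁ + m₂ + m₃)) ≡ false
state-even {m₁ = m₁} {m₂} {m₃} {w = w} (state {pre} {pre'} {w'} apart bound e₁ e₂ e₃ same) =
  apart-≡⇒even (subst (Apart _ (length (pre ++ _))) (cong length (sym same))
    (subst₂ (Apart _) (sym (length-++ pre)) (sym (length-++ pre'))
      (apart-+ apart (subst (λ c → Apart c (length w) (length w')) (rotate m₁ m₂ m₃)
        (apart-trans (apart-sym (edits-apart e₂)) (apart-trans (edits-apart e₁) (edits-apart e₃)))))))
  where
  rotate : ∀ a b c → b + (a + c) ≡ a + b + c
  rotate = solve-∀

parity-next : ∀ s {c₁ c₂ c c₃ a b} → odd s ≡ a → c₁ + c₂ ≡ c → odd c₃ ≡ b → odd (s + (c₁ + c₂ + c₃)) ≡ a xor (odd c xor b)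
parity-next s {c₁} {c₂} {c₃ = c₃} refl refl refl = trans (odd-+ s (c₁ + c₂ + c₃)) (cong (odd s xor_) (odd-+ (c₁ + c₂) c₃))

gather : ∀ {c₁ c₂ c} n₁ n₂ → c₁ + c₂ ≡ c → c₁ + n₁ + (c₂ + n₂) ≡ c + (n₁ + n₂)
gather {c₁} {c₂} n₁ n₂ refl = interchange c₁ n₁ c₂ n₂
  where
  interchange : ∀ a b c e → a + b + (c + e) ≡ a + c + (b + e)
  interchange = solve-∀

even⇒2≤ : ∀ {n} → odd n ≡ false → n ≢ 0 → 2 ≤ n
even⇒2≤ {zero} _ n≢0 = ⊥-elim (n≢0 refl)
even⇒2≤ {suc (suc n)} _ _ = s≤s (s≤s z≤n)


collide : ∀ {r u us s m₁ m₂ m₃ v w} (st : Step r u us s m₁ m₂ m₃ v w) → let open Step st in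
  2 ≤ c₁ + c₂ → Collision (u ∷ us) v w m₁ m₂
collide {us = us} (step refl refl refl refl refl e₁ e₂ rest _) 2≤ =
  collision-here e₁ e₂ (head-edits us (State.e₁ rest) (State.e₂ rest)) (≤-trans 2≤ (m≤m+n _ 0))

collide-next : ∀ {r u us s m₁ m₂ m₃ v w} (st : Step r u us s m₁ m₂ m₃ v w) → let open Step st in
  c₁ + c₂ ≡ 1 → HeadEdits 1 us v₂ w₂ n₁ n₂ → Collision (u ∷ us) v w m₁ m₂
collide-next (step refl refl refl refl refl e₁ e₂ _ _) c≡ h =
  collision-here e₁ e₂ h (≤-reflexive (cong (_+ 1) (sym c≡)))

collide-later : ∀ {r u us s m₁ m₂ m₃ v w} (st : Step r u us s m₁ m₂ m₃ v w) → let open Step st in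
  Collision us v₂ w₂ n₁ n₂ → Collision (u ∷ us) v w m₁ m₂
collide-later (step refl refl refl refl refl e₁ e₂ _ _) = collision-there e₁ e₂

step-≤ : ∀ {r u us s m₁ m₂ m₃ v w} (st : Step r u us s m₁ m₂ m₃ v w) → let open Step st in
  ∀ {c} → c₁ + c₂ ≡ c → ∀ a b → a + (c + (n₁ + n₂)) ≤ b + (c₃ + n₃) → a + (m₁ + m₂) ≤ b + m₃
step-≤ (step {c₁} {c₂} {n₁ = n₁} {n₂} refl refl refl refl refl _ _ _ _) c≡ a b le =
  ≤-trans (≤-reflexive (cong (a +_) (gather {c₁} {c₂} n₁ n₂ c≡))) le

step-parity : ∀ {r u us s m₁ m₂ m₃ v w} (st : Step r u us s m₁ m₂ m₃ v w) → let open Step st in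
  ∀ {a c b} → odd s ≡ a → c₁ + c₂ ≡ c → odd c₃ ≡ b → odd (s + (c₁ + c₂ + c₃)) ≡ a xor (odd c xor b)
step-parity {s = s} st = parity-next s {c₁} {c₂} {c₃ = c₃}
  where open Step st

last-collision : ∀ {r s m₁ m₂ m₃ v w} → State r [] s m₁ m₂ m₃ v w → 2 ≤ m₁ + m₂ → Collision [] v w m₁ m₂
last-collision {m₁ = m₁} {m₂} {v = v} {w} (state _ _ e₁ e₂ _ _) 2≤ =
  collision (here refl) (sym (+-identityʳ m₁)) (sym (+-identityʳ m₂)) (sym (++-identityʳ v)) (sym (++-identityʳ w))
    [] e₁ [] [] e₂ [] 2≤

last-parity : ∀ {r s m₁ m₂ m₃ v w} → State r [] s m₁ m₂ m₃ v w → ∀ {a c b} →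
  odd s ≡ a → m₁ + m₂ ≡ c → odd m₃ ≡ b → a xor (odd c xor b) ≡ false
last-parity {s = s} {m₁} {m₂} {m₃} st s≡ c≡ b≡ = trans (sym (parity-next s {m₁} {m₂} {c₃ = m₃} s≡ c≡ b≡)) (state-even st)

-- Edits of the third alignment pay for those of the first two: a block with exactly one edit of the first two
-- alignments leaves the offset odd, and an odd offset forbids an unedited aperiodic block.
mutual
  pay-even : ∀ {r} us → All (Aperiodic r) us → ∀ {s m₁ m₂ m₃ v w} → State r us s m₁ m₂ m₃ v w → odd s ≡ false →
    m₁ + m₂ ≤ m₃ ⊎ Collision us v w m₁ m₂
  pay-even [] _ {m₁ = m₁} {m₂} {m₃} st s≡ with m₁ + m₂ in c≡ | odd m₃ in b≡
  ... | 0 | _ = inj₁ z≤n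
  ... | 1 | true = inj₁ (odd⇒1≤ b≡)
  -- A single remaining edit with an even `m₃` would close the triangle with an odd total.
  ... | 1 | false with () ← last-parity st s≡ c≡ b≡
  ... | suc (suc _) | _ = inj₂ (last-collision st (≤-trans (s≤s (s≤s z≤n)) (≤-reflexive (sym c≡))))
  pay-even (u ∷ us) (ap ∷ aps) {s} {m₁} {m₂} {m₃} {v} {w} st s≡ = go (state-step ap st)
    where
    go : Step _ u us s m₁ m₂ m₃ v w → m₁ + m₂ ≤ m₃ ⊎ Collision (u ∷ us) v w m₁ m₂
    go S with Step.c₁ S + Step.c₂ S in c≡ | odd (Step.c₃ S) in b≡
    go S | 0 | false with pay-even us aps (Step.rest S) (step-parity S s≡ c≡ b≡)
    ... | inj₁ le = inj₁ (step-≤ S c≡ 0 0 (≤-trans le (m≤n+m _ _)))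
    ... | inj₂ h = inj₂ (collide-later S h)
    go S | 0 | true with pay-odd us aps (Step.rest S) (step-parity S s≡ c≡ b≡)
    ... | inj₁ le = inj₁ (step-≤ S c≡ 0 0 (≤-trans le (+-monoˡ-≤ _ (odd⇒1≤ b≡))))
    ... | inj₂ h = inj₂ (collide-later S h)
    go S | 1 | true with pay-even us aps (Step.rest S) (step-parity S s≡ c≡ b≡)
    ... | inj₁ le = inj₁ (step-≤ S c≡ 0 0 (+-mono-≤ (odd⇒1≤ b≡) le))
    ... | inj₂ h = inj₂ (collide-later S h)
    go S | 1 | false with pay-debt us aps (Step.rest S) (step-parity S s≡ c≡ b≡)
    ... | inj₁ le = inj₁ (step-≤ S c≡ 0 0 (≤-trans le (m≤n+m _ _)))
    ... | inj₂ (inj₁ h) = inj₂ (collide-next S c≡ h)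
    ... | inj₂ (inj₂ h) = inj₂ (collide-later S h)
    go S | suc (suc _) | _ = inj₂ (collide S (≤-trans (s≤s (s≤s z≤n)) (≤-reflexive (sym c≡))))

  -- Here the odd offset stems from an edit of the third alignment that is still in credit, so one
  -- edit of the other two may go unpaid.
  pay-odd : ∀ {r} us → All (Aperiodic r) us → ∀ {s m₁ m₂ m₃ v w} → State r us s m₁ m₂ m₃ v w → odd s ≡ true →
    m₁ + m₂ ≤ suc m₃ ⊎ Collision us v w m₁ m₂
  pay-odd [] _ {m₁ = m₁} {m₂} {m₃} st s≡ with m₁ + m₂ in c≡
  ... | 0 = inj₁ z≤n
  ... | 1 = inj₁ (s≤s z≤n)
  ... | suc (suc _) = inj₂ (last-collision st (≤-trans (s≤s (s≤s z≤n)) (≤-reflexive (sym c≡))))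
  pay-odd (u ∷ us) (ap ∷ aps) {s} {m₁} {m₂} {m₃} {v} {w} st s≡ = go (state-step ap st)
    where
    go : Step _ u us s m₁ m₂ m₃ v w → m₁ + m₂ ≤ suc m₃ ⊎ Collision (u ∷ us) v w m₁ m₂
    go S with Step.c₁ S + Step.c₂ S in c≡ | odd (Step.c₃ S) in b≡
    go S | 0 | false with pay-odd us aps (Step.rest S) (step-parity S s≡ c≡ b≡)
    ... | inj₁ le = inj₁ (step-≤ S c≡ 0 1 (≤-trans le (s≤s (m≤n+m _ _))))
    ... | inj₂ h = inj₂ (collide-later S h)
    go S | 0 | true with pay-even us aps (Step.rest S) (step-parity S s≡ c≡ b≡)
    ... | inj₁ le = inj₁ (step-≤ S c≡ 0 1 (≤-trans le (m≤n⇒m≤1+n (m≤n+m _ _))))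
    ... | inj₂ h = inj₂ (collide-later S h)
    go S | 1 | false with pay-even us aps (Step.rest S) (step-parity S s≡ c≡ b≡)
    ... | inj₁ le = inj₁ (step-≤ S c≡ 0 1 (s≤s (≤-trans le (m≤n+m _ _))))
    ... | inj₂ h = inj₂ (collide-later S h)
    go S | 1 | true with pay-debt us aps (Step.rest S) (step-parity S s≡ c≡ b≡)
    ... | inj₁ le = inj₁ (step-≤ S c≡ 0 1 (≤-trans le (m≤n⇒m≤1+n (m≤n+m _ _))))
    ... | inj₂ (inj₁ h) = inj₂ (collide-next S c≡ h)
    ... | inj₂ (inj₂ h) = inj₂ (collide-later S h)
    go S | suc (suc _) | _ = inj₂ (collide S (≤-trans (s≤s (s≤s z≤n)) (≤-reflexive (sym c≡))))

  -- Here the odd offset stems from an unpaid edit in the block just before. The first block of `us`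
  -- either has an edit of its own, which collides with that one, or must contain an edit of the
  -- third alignment, since an odd offset cannot cross it unedited.
  pay-debt : ∀ {r} us → All (Aperiodic r) us → ∀ {s m₁ m₂ m₃ v w} → State r us s m₁ m₂ m₃ v w → odd s ≡ true →
    suc (m₁ + m₂) ≤ m₃ ⊎ HeadEdits 1 us v w m₁ m₂ ⊎ Collision us v w m₁ m₂
  pay-debt [] _ {m₁ = m₁} {m₂} {m₃} {v} {w} st s≡ with m₁ + m₂ in c≡ | odd m₃ in b≡
  ... | 0 | true = inj₁ (odd⇒1≤ b≡)
  ... | 0 | false with () ← last-parity st s≡ c≡ b≡
  ... | suc _ | _ = inj₂ (inj₁ (headEdits (sym (+-identityʳ m₁)) (sym (+-identityʳ m₂)) (sym (++-identityʳ v)) (sym (++-identityʳ w))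
          (State.e₁ st) [] (State.e₂ st) [] (≤-trans (s≤s z≤n) (≤-reflexive (sym c≡)))))
  pay-debt (u ∷ us) (ap ∷ aps) {s} {m₁} {m₂} {m₃} {v} {w} st s≡ = go (state-step ap st)
    where
    go : Step _ u us s m₁ m₂ m₃ v w → suc (m₁ + m₂) ≤ m₃ ⊎ HeadEdits 1 (u ∷ us) v w m₁ m₂ ⊎ Collision (u ∷ us) v w m₁ m₂
    go S with Step.c₁ S + Step.c₂ S in c≡ | odd (Step.c₃ S) in b≡
    go S | 0 | true with pay-even us aps (Step.rest S) (step-parity S s≡ c≡ b≡)
    ... | inj₁ le = inj₁ (step-≤ S c≡ 1 0 (+-mono-≤ (odd⇒1≤ b≡) le))
    ... | inj₂ h = inj₂ (inj₂ (collide-later S h))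
    go S | 0 | false with pay-odd us aps (Step.rest S) (step-parity S s≡ c≡ b≡)
    -- An even, nonzero `c₃` is at least 2: one edit settles the debt and the other is the credit
    -- for `pay-odd`.
    ... | inj₁ le = inj₁ (step-≤ S c≡ 1 0 (≤-trans (s≤s le)
            (+-monoˡ-≤ _ (even⇒2≤ b≡ (λ c₃≡0 → Step.unclean S s≡ (cong₂ _+_ c≡ c₃≡0))))))
    ... | inj₂ h = inj₂ (inj₂ (collide-later S h))
    go (step refl refl refl refl refl e₁ e₂ rest _) | suc _ | _ = inj₂ (inj₁ (headEdits refl refl refl refl e₁ (State.e₁ rest) e₂ (State.e₂ rest)
          (≤-trans (s≤s z≤n) (≤-reflexive (sym c≡)))))

-- The walk starts at offset zero, and no offset exceeds the number of edits used, so aperiodicity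
-- up to the total number of edits suffices.
triangle : ∀ {r} us → All (Aperiodic r) us → ∀ {m₁ m₂ m₃ v w} → m₁ + m₂ + m₃ ≤ r →
  Edits m₁ (concat us) v → Edits m₂ (concat us) w → Edits m₃ v w → m₁ + m₂ ≤ m₃ ⊎ Collision us v w m₁ m₂
triangle us aps bound e₁ e₂ e₃ =
  pay-even us aps (state {pre = []} {pre' = []} (0 , 0 , refl , refl) bound e₁ e₂ e₃ refl) refl

-- Counting by enumeration

∈-remove : ∀ {A : Set} {u v : A} as {bs} → u ∈ as ++ v ∷ bs → u ≢ v → u ∈ as ++ bs
∈-remove as i u≢v with ∈-++⁻ as i
... | inj₁ i∈as = ∈-++⁺ˡ i∈as
... | inj₂ (here u≡v) = ⊥-elim (u≢v u≡v)
... | inj₂ (there i∈bs) = ∈-++⁺ʳ as i∈bs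

-- Only `V` has to be free of repetitions; `ys` may list an element several times, as the
-- enumerations of neighbours do.
count-≤ : ∀ {A : Set} (p : A → Bool) {V ys} → Unique V → (∀ {v} → v ∈ V → p v ≡ true → v ∈ ys) →
  ∑ (λ v → ⟦ p v ⟧) V ≤ length ys
count-≤ p [] h = z≤n
count-≤ p {v ∷ V} {ys} (v∉ ∷ uniq) h with p v in pv
... | false = count-≤ p uniq (λ i → h (there i))
... | true with as , bs , refl ← ∈-∃++ (h (here refl) pv) = begin
    suc (∑ (λ u → ⟦ p u ⟧) V)          ≤⟨ s≤s (count-≤ p uniq (λ i pu → ∈-remove as (h (there i) pu) (λ { refl → All.lookup v∉ i refl }))) ⟩
    suc (length (as ++ bs))            ≡⟨ cong suc (length-++ as) ⟩
    suc (length as + length bs)        ≡⟨ +-suc (length as) (length bs) ⟨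
    length as + suc (length bs)        ≡⟨ length-++ as ⟨
    length (as ++ v ∷ bs)              ∎
  where open ≤-Reasoning

unique-length-≤ : ∀ {A : Set} {xs ys : List A} → Unique xs → (∀ {x} → x ∈ xs → x ∈ ys) → length xs ≤ length ys
unique-length-≤ {xs = xs} uniq h = ≤-trans
  (≤-reflexive (sym (trans (∑-const 1 xs) (*-identityʳ (length xs)))))
  (count-≤ (λ _ → true) uniq (λ i _ → h i))

∑-cartesianProduct : ∀ {A B : Set} (f : A × B → ℕ) xs ys →
  ∑ f (cartesianProduct xs ys) ≡ ∑ (λ x → ∑ (λ y → f (x , y)) ys) xs
∑-cartesianProduct f [] ys = refl
∑-cartesianProduct f (x ∷ xs) ys = trans (∑-++ f (map (x ,_) ys) (cartesianProduct xs ys))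
  (cong₂ _+_ (∑-map ys) (∑-cartesianProduct f xs ys))
  where
  ∑-map : ∀ ys → ∑ f (map (x ,_) ys) ≡ ∑ (λ y → f (x , y)) ys
  ∑-map [] = refl
  ∑-map (y ∷ ys) = cong (f (x , y) +_) (∑-map ys)

length-cartesianProductWith : ∀ {A B C : Set} (f : A → B → C) xs ys →
  length (cartesianProductWith f xs ys) ≡ length xs * length ys
length-cartesianProductWith f [] ys = refl
length-cartesianProductWith f (x ∷ xs) ys = trans (length-++ (map (f x) ys))
  (cong₂ _+_ (length-map (f x) ys) (length-cartesianProductWith f xs ys))

length-concatMap-≤ : ∀ {A B : Set} (f : A → List B) xs {N} → (∀ {x} → x ∈ xs → length (f x) ≤ N) →
  length (concatMap f xs) ≤ length xs * N
length-concatMap-≤ f [] h = z≤n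
length-concatMap-≤ f (x ∷ xs) h = ≤-trans (≤-reflexive (length-++ (f x)))
  (+-mono-≤ (h (here refl)) (length-concatMap-≤ f xs (λ i → h (there i))))

∈-concatMap : ∀ {A B : Set} (f : A → List B) {x xs y} → x ∈ xs → y ∈ f x → y ∈ concatMap f xs
∈-concatMap f x∈ y∈ = ∈-concatMap⁺ f (lose x∈ y∈)

-- Enumeration of neighbours and of triangles

nbr₁ : Word → List Word
nbr₁ [] = (false ∷ []) ∷ (true ∷ []) ∷ []
nbr₁ (x ∷ u) = (false ∷ x ∷ u) ∷ (true ∷ x ∷ u) ∷ u ∷ map (x ∷_) (nbr₁ u)

nbr : ℕ → Word → List Word
nbr zero u = u ∷ []
nbr (suc m) u = concatMap (nbr m) (nbr₁ u)

length-nbr₁ : ∀ u → length (nbr₁ u) ≡ 3 * length u + 2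
length-nbr₁ [] = refl
length-nbr₁ (x ∷ u) = trans (cong (3 +_) (trans (length-map (x ∷_) (nbr₁ u)) (length-nbr₁ u))) (shift-3 (length u))
  where
  shift-3 : ∀ n → 3 + (3 * n + 2) ≡ 3 * suc n + 2
  shift-3 = solve-∀

∈-nbr₁-length : ∀ u {u'} → u' ∈ nbr₁ u → length u' ≤ suc (length u)
∈-nbr₁-length [] (here refl) = ≤-refl
∈-nbr₁-length [] (there (here refl)) = ≤-refl
∈-nbr₁-length (x ∷ u) (here refl) = ≤-refl
∈-nbr₁-length (x ∷ u) (there (here refl)) = ≤-refl
∈-nbr₁-length (x ∷ u) (there (there (here refl))) = m≤n⇒m≤1+n (n≤1+n _)
∈-nbr₁-length (x ∷ u) (there (there (there i))) with _ , i' , refl ← ∈-map⁻ (x ∷_) i = s≤s (∈-nbr₁-length u i')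

-- `N` bounds the number of choices at every stage, because a word grows by at most one letter per
-- edit.
length-nbr : ∀ m u {N} → 3 * (length u + m) + 2 ≤ N → length (nbr m u) ≤ N ^ m
length-nbr zero u _ = ≤-refl
length-nbr (suc m) u {N} le = ≤-trans (length-concatMap-≤ (nbr m) (nbr₁ u) (λ {u'} i → length-nbr m u' (≤-trans (smaller i) le)))
  (*-monoˡ-≤ (N ^ m) (≤-trans (≤-reflexive (length-nbr₁ u)) (≤-trans (+-monoˡ-≤ 2 (*-monoʳ-≤ 3 (m≤m+n (length u) (suc m)))) le)))
  where
  smaller : ∀ {u'} → u' ∈ nbr₁ u → 3 * (length u' + m) + 2 ≤ 3 * (length u + suc m) + 2
  smaller i = +-monoˡ-≤ 2 (*-monoʳ-≤ 3 (≤-trans (+-monoˡ-≤ m (∈-nbr₁-length u i)) (≤-reflexive (sym (+-suc (length u) m)))))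

-- The leftmost edit is carried out first; a letter inserted by it is kept afterwards.
first-edit : ∀ {m u v} → Edits (suc m) u v → ∃[ u' ] (u' ∈ nbr₁ u × Edits m u' v)
first-edit (keep x e) with u' , i , e' ← first-edit e = x ∷ u' , there (there (there (∈-map⁺ (x ∷_) i))) , keep x e'
first-edit (del x e) = _ , there (there (here refl)) , e
first-edit {u = []} (ins false e) = _ , here refl , keep false e
first-edit {u = []} (ins true e) = _ , there (here refl) , keep true e
first-edit {u = x ∷ u} (ins false e) = _ , here refl , keep false e
first-edit {u = x ∷ u} (ins true e) = _ , there (here refl) , keep true e

∈-nbr : ∀ {m u v} → Edits m u v → v ∈ nbr m u
∈-nbr {zero} e = here (sym (edits-zero e))
∈-nbr {suc m} e with u' , i , e' ← first-edit e = ∈-concatMap (nbr m) i (∈-nbr e')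

ball : ℕ → Word → List Word
ball d u = concatMap (λ m → nbr m u) (upTo (suc d))

∈-ball : ∀ {m d u v} → m ≤ d → Edits m u v → v ∈ ball d u
∈-ball {u = u} m≤d e = ∈-concatMap (λ m → nbr m u) (∈-upTo⁺ (s≤s m≤d)) (∈-nbr e)

length-nbr-≤ : ∀ {m d} u {N} → m ≤ d → 3 * (length u + d) + 2 ≤ N → length (nbr m u) ≤ N ^ m
length-nbr-≤ {m} u m≤d le = length-nbr m u (≤-trans (+-monoˡ-≤ 2 (*-monoʳ-≤ 3 (+-monoʳ-≤ (length u) m≤d))) le)

N≢0 : ∀ {x N} → x + 2 ≤ N → NonZero N
N≢0 {x} le = >-nonZero (≤-trans (m≤n+m 1 (suc x)) (≤-trans (≤-reflexive (sym (+-suc x 1))) le))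

length-ball : ∀ d u {N} → 3 * (length u + d) + 2 ≤ N → length (ball d u) ≤ suc d * N ^ d
length-ball d u {N} le = ≤-trans
  (length-concatMap-≤ (λ m → nbr m u) (upTo (suc d))
    (λ i → let m≤d = ≤-pred (∈-upTo⁻ i) in ≤-trans (length-nbr-≤ u m≤d le) (^-monoʳ-≤ N {{N≢0 le}} m≤d)))
  (≤-reflexive (cong (_* N ^ d) (length-upTo (suc d))))

windows-concat : ∀ us {U₁ U₂ U₃} → (U₁ , U₂ , U₃) ∈ windows us → U₁ ++ U₂ ++ U₃ ≡ concat us
windows-concat [] (here refl) = refl
windows-concat (u ∷ us) (here refl) = trans (++-assoc u (headBlock us) (concat (tailBlocks us))) (cong (u ++_) (tail≡ us))
  where
  tail≡ : ∀ us → headBlock us ++ concat (tailBlocks us) ≡ concat us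
  tail≡ [] = refl
  tail≡ (u ∷ us) = refl
windows-concat (u ∷ us) (there i) with (U₁ , U₂ , U₃) , i' , refl ← ∈-map⁻ _ i =
  trans (++-assoc u U₁ _) (cong (u ++_) (windows-concat us i'))

windows-middle : ∀ {ℓ} us → All (λ u → length u ≤ ℓ) us → ∀ {U₁ U₂ U₃} → (U₁ , U₂ , U₃) ∈ windows us → length U₂ ≤ ℓ + ℓ
windows-middle [] _ (here refl) = z≤n
windows-middle {ℓ} (u ∷ us) (le ∷ les) (here refl) = ≤-trans (≤-reflexive (length-++ u)) (+-mono-≤ le (head≤ us les))
  where
  head≤ : ∀ us → All (λ u → length u ≤ ℓ) us → length (headBlock us) ≤ ℓ
  head≤ [] _ = z≤n
  head≤ (u ∷ us) (le ∷ _) = le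
windows-middle (u ∷ us) (le ∷ les) (there i) with _ , i' , refl ← ∈-map⁻ _ i = windows-middle us les i'

length-windows : ∀ us → length (windows us) ≡ suc (length us)
length-windows [] = refl
length-windows (u ∷ us) = cong suc (trans (length-map _ (windows us)) (length-windows us))

nbr₃ : ℕ × ℕ × ℕ → Word × Word × Word → List Word
nbr₃ (p₁ , p₂ , p₃) (U₁ , U₂ , U₃) =
  cartesianProductWith _++_ (nbr p₁ U₁) (cartesianProductWith _++_ (nbr p₂ U₂) (nbr p₃ U₃))

Fits₂ : ℕ → ℕ × ℕ → Set
Fits₂ d (m , n) = m + n ≤ d

Fits₃ : ℕ → ℕ × ℕ × ℕ → Set
Fits₃ d (p₁ , p₂ , p₃) = p₁ + (p₂ + p₃) ≤ d

Collides : (ℕ × ℕ × ℕ) × (ℕ × ℕ × ℕ) → Set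
Collides ((_ , p₂ , _) , (_ , q₂ , _)) = 2 ≤ p₂ + q₂

fits₂? : ∀ d t → Dec (Fits₂ d t)
fits₂? d (m , n) = m + n ≤? d

fits₃? : ∀ d t → Dec (Fits₃ d t)
fits₃? d (p₁ , p₂ , p₃) = p₁ + (p₂ + p₃) ≤? d

collides? : ∀ t → Dec (Collides t)
collides? ((_ , p₂ , _) , (_ , q₂ , _)) = 2 ≤? p₂ + q₂

upTo² : ℕ → List (ℕ × ℕ)
upTo² d = cartesianProduct (upTo (suc d)) (upTo (suc d))

budgets : ℕ → List (ℕ × ℕ)
budgets d = filter (fits₂? d) (upTo² d)

triples : ℕ → List (ℕ × ℕ × ℕ)
triples d = filter (fits₃? d) (cartesianProduct (upTo (suc d)) (upTo² d))

collisionBudgets : ℕ → List ((ℕ × ℕ × ℕ) × (ℕ × ℕ × ℕ))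
collisionBudgets d = filter collides? (cartesianProduct (triples d) (triples d))

∈-triples : ∀ {d} p₁ p₂ p₃ → p₁ + (p₂ + p₃) ≤ d → (p₁ , p₂ , p₃) ∈ triples d
∈-triples {d} p₁ p₂ p₃ le = ∈-filter⁺ (fits₃? d) (∈-cartesianProduct⁺ (∈-upTo⁺ (s≤s (≤-trans (m≤m+n p₁ _) le)))
  (∈-cartesianProduct⁺ (∈-upTo⁺ (s≤s (≤-trans (≤-trans (m≤m+n p₂ p₃) (m≤n+m _ p₁)) le)))
    (∈-upTo⁺ (s≤s (≤-trans (≤-trans (m≤n+m p₃ p₂) (m≤n+m _ p₁)) le))))) le

nbr² : Word → ℕ × ℕ → List (Word × Word)
nbr² u (m , n) = cartesianProduct (nbr m u) (nbr n u)

nbr₃² : Word × Word × Word → (ℕ × ℕ × ℕ) × (ℕ × ℕ × ℕ) → List (Word × Word)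
nbr₃² U (p , q) = cartesianProduct (nbr₃ p U) (nbr₃ q U)

-- Pairs reached with at most d edits altogether, where two arbitrary neighbours may need 2d. They
-- arise when the edits between v and w pay for those leading to v and w.
cheapPairs : ℕ → Word → List (Word × Word)
cheapPairs d u = concatMap (nbr² u) (budgets d)

collidingPairs : ℕ → List Word → List (Word × Word)
collidingPairs d us = concatMap (λ U → concatMap (nbr₃² U) (collisionBudgets d)) (windows us)

∈-cheapPairs : ∀ {d u v w m n} → m + n ≤ d → Edits m u v → Edits n u w → (v , w) ∈ cheapPairs d u
∈-cheapPairs {d} {u} {m = m} {n} le e f = ∈-concatMap (nbr² u)
  (∈-filter⁺ (fits₂? d) (∈-cartesianProduct⁺ (∈-upTo⁺ (s≤s (≤-trans (m≤m+n m n) le))) (∈-upTo⁺ (s≤s (≤-trans (m≤n+m n m) le)))) le)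
  (∈-cartesianProduct⁺ (∈-nbr e) (∈-nbr f))

∈-collidingPairs : ∀ {d us v w m n} → m ≤ d → n ≤ d → Collision us v w m n → (v , w) ∈ collidingPairs d us
∈-collidingPairs {d} {us} m≤d n≤d
  (collision {U₁} {U₂} {U₃} {p₁ = p₁} {p₂} {p₃} {q₁} {q₂} {q₃} window refl refl refl refl ev₁ ev₂ ev₃ ew₁ ew₂ ew₃ 2≤) =
  ∈-concatMap (λ U → concatMap (nbr₃² U) (collisionBudgets d)) window
    (∈-concatMap (nbr₃² (U₁ , U₂ , U₃))
      (∈-filter⁺ collides? (∈-cartesianProduct⁺ (∈-triples p₁ p₂ p₃ m≤d) (∈-triples q₁ q₂ q₃ n≤d)) 2≤)
      (∈-cartesianProduct⁺
        (∈-cartesianProductWith⁺ _++_ (∈-nbr ev₁) (∈-cartesianProductWith⁺ _++_ (∈-nbr ev₂) (∈-nbr ev₃)))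
        (∈-cartesianProductWith⁺ _++_ (∈-nbr ew₁) (∈-cartesianProductWith⁺ _++_ (∈-nbr ew₂) (∈-nbr ew₃)))))

length-cheapPairs : ∀ d u {N} → 3 * (length u + d) + 2 ≤ N → length (cheapPairs d u) ≤ length (budgets d) * N ^ d
length-cheapPairs d u {N} le = length-concatMap-≤ (nbr² u) (budgets d) λ { {m , n} i → bound m n i }
  where
  open ≤-Reasoning
  bound : ∀ m n → (m , n) ∈ budgets d → length (cartesianProduct (nbr m u) (nbr n u)) ≤ N ^ d
  bound m n i with _ , m+n≤d ← ∈-filter⁻ (fits₂? d) {xs = upTo² d} i = begin
    length (cartesianProduct (nbr m u) (nbr n u))   ≡⟨ length-cartesianProductWith _,_ (nbr m u) (nbr n u) ⟩
    length (nbr m u) * length (nbr n u)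
      ≤⟨ *-mono-≤ (length-nbr-≤ u (≤-trans (m≤m+n m n) m+n≤d) le) (length-nbr-≤ u (≤-trans (m≤n+m n m) m+n≤d) le) ⟩
    N ^ m * N ^ n                                   ≡⟨ ^-distribˡ-+-* N m n ⟨
    N ^ (m + n)                                     ≤⟨ ^-monoʳ-≤ N {{N≢0 le}} m+n≤d ⟩
    N ^ d                                           ∎

length-nbr₃ : ∀ {d} p₁ p₂ p₃ U₁ U₂ U₃ {N B} → p₁ + (p₂ + p₃) ≤ d →
  3 * (length (U₁ ++ U₂ ++ U₃) + d) + 2 ≤ N → 3 * (length U₂ + d) + 2 ≤ B →
  length (nbr₃ (p₁ , p₂ , p₃) (U₁ , U₂ , U₃)) ≤ N ^ p₁ * (B ^ p₂ * N ^ p₃)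
length-nbr₃ {d} p₁ p₂ p₃ U₁ U₂ U₃ {N} {B} le leN leB = begin
  length (nbr₃ (p₁ , p₂ , p₃) (U₁ , U₂ , U₃))
    ≡⟨ trans (length-cartesianProductWith _++_ (nbr p₁ U₁) _)
         (cong (length (nbr p₁ U₁) *_) (length-cartesianProductWith _++_ (nbr p₂ U₂) (nbr p₃ U₃))) ⟩
  length (nbr p₁ U₁) * (length (nbr p₂ U₂) * length (nbr p₃ U₃))
    ≤⟨ *-mono-≤ (length-nbr-≤ U₁ (≤-trans (m≤m+n p₁ _) le) (≤-trans (shrink (length U₁) (subst (length U₁ ≤_) (sym total) (m≤m+n _ _))) leN))
        (*-mono-≤ (length-nbr-≤ U₂ (≤-trans (≤-trans (m≤m+n p₂ p₃) (m≤n+m _ p₁)) le) leB)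
                  (length-nbr-≤ U₃ (≤-trans (≤-trans (m≤n+m p₃ p₂) (m≤n+m _ p₁)) le)
                    (≤-trans (shrink (length U₃) (subst (length U₃ ≤_) (sym total) (≤-trans (m≤n+m _ (length U₂)) (m≤n+m _ (length U₁))))) leN))) ⟩
  N ^ p₁ * (B ^ p₂ * N ^ p₃) ∎
  where
  open ≤-Reasoning
  total : length (U₁ ++ U₂ ++ U₃) ≡ length U₁ + (length U₂ + length U₃)
  total = trans (length-++ U₁) (cong (length U₁ +_) (length-++ U₂))
  shrink : ∀ x → x ≤ length (U₁ ++ U₂ ++ U₃) → 3 * (x + d) + 2 ≤ 3 * (length (U₁ ++ U₂ ++ U₃) + d) + 2
  shrink x x≤ = +-monoˡ-≤ 2 (*-monoʳ-≤ 3 (+-monoˡ-≤ d x≤))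

-- Only two of the edits inside a window are charged at the low rate B; any further ones are charged
-- at the full rate N.
pow-trade : ∀ {B N} .{{_ : NonZero N}} → B ≤ N → ∀ {a D} c → 2 ≤ c → a + c ≤ D + 2 → N ^ a * B ^ c ≤ N ^ D * B ^ 2
pow-trade {B} {N} B≤N {a} {D} (suc (suc c)) (s≤s (s≤s _)) le = begin
  N ^ a * B ^ (2 + c)          ≡⟨ cong (N ^ a *_) (^-distribˡ-+-* B 2 c) ⟩
  N ^ a * (B ^ 2 * B ^ c)      ≤⟨ *-monoʳ-≤ (N ^ a) (*-monoʳ-≤ (B ^ 2) (^-monoˡ-≤ c B≤N)) ⟩
  N ^ a * (B ^ 2 * N ^ c)      ≡⟨ regroup (N ^ a) (B ^ 2) (N ^ c) ⟩
  N ^ a * N ^ c * B ^ 2        ≡⟨ cong (_* B ^ 2) (^-distribˡ-+-* N a c) ⟨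
  N ^ (a + c) * B ^ 2          ≤⟨ *-monoˡ-≤ (B ^ 2) (^-monoʳ-≤ N (+-cancelʳ-≤ 2 (a + c) D (≤-trans (≤-reflexive (a+c+2 a c)) le))) ⟩
  N ^ D * B ^ 2                ∎
  where
  open ≤-Reasoning
  regroup : ∀ a b c → a * (b * c) ≡ a * c * b
  regroup = solve-∀
  a+c+2 : ∀ a c → a + c + 2 ≡ a + (2 + c)
  a+c+2 = solve-∀

-- At most 2d = D + 2 edits lead to the two neighbours. Once the window is chosen, two of them have
-- at most B choices each, and the others at most N each.
length-collidingPairs : ∀ {d D ℓ} us {N B} → D + 2 ≡ d + d → All (λ u → length u ≤ ℓ) us →
  3 * (length (concat us) + d) + 2 ≤ N → 3 * (ℓ + ℓ + d) + 2 ≤ B → B ≤ N →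
  length (collidingPairs d us) ≤ suc (length us) * (length (collisionBudgets d) * (N ^ D * B ^ 2))
length-collidingPairs {d} {D} {ℓ} us {N} {B} D≡ short leN leB B≤N = ≤-trans
  (length-concatMap-≤ (λ U → concatMap (nbr₃² U) (collisionBudgets d)) (windows us) λ { {U₁ , U₂ , U₃} i →
    length-concatMap-≤ (nbr₃² (U₁ , U₂ , U₃)) (collisionBudgets d) λ { {(p₁ , p₂ , p₃) , (q₁ , q₂ , q₃)} j → bound U₁ U₂ U₃ p₁ p₂ p₃ q₁ q₂ q₃ i j } })
  (≤-reflexive (cong (_* (length (collisionBudgets d) * (N ^ D * B ^ 2))) (length-windows us)))
  where
  open ≤-Reasoning
  bound : ∀ U₁ U₂ U₃ p₁ p₂ p₃ q₁ q₂ q₃ → (U₁ , U₂ , U₃) ∈ windows us →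
    ((p₁ , p₂ , p₃) , (q₁ , q₂ , q₃)) ∈ collisionBudgets d →
    length (cartesianProduct (nbr₃ (p₁ , p₂ , p₃) (U₁ , U₂ , U₃)) (nbr₃ (q₁ , q₂ , q₃) (U₁ , U₂ , U₃))) ≤ N ^ D * B ^ 2
  bound U₁ U₂ U₃ p₁ p₂ p₃ q₁ q₂ q₃ i j
    with j' , 2≤ ← ∈-filter⁻ collides? {xs = cartesianProduct (triples d) (triples d)} j
    with jp , jq ← ∈-cartesianProduct⁻ (triples d) (triples d) j'
    with _ , p≤ ← ∈-filter⁻ (fits₃? d) {xs = cartesianProduct (upTo (suc d)) (upTo² d)} jp
       | _ , q≤ ← ∈-filter⁻ (fits₃? d) {xs = cartesianProduct (upTo (suc d)) (upTo² d)} jq = begin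
    length (cartesianProduct (nbr₃ (p₁ , p₂ , p₃) U) (nbr₃ (q₁ , q₂ , q₃) U))
      ≡⟨ length-cartesianProductWith _,_ (nbr₃ (p₁ , p₂ , p₃) U) (nbr₃ (q₁ , q₂ , q₃) U) ⟩
    length (nbr₃ (p₁ , p₂ , p₃) U) * length (nbr₃ (q₁ , q₂ , q₃) U)
      ≤⟨ *-mono-≤ (length-nbr₃ p₁ p₂ p₃ U₁ U₂ U₃ p≤ leN' leB') (length-nbr₃ q₁ q₂ q₃ U₁ U₂ U₃ q≤ leN' leB') ⟩
    N ^ p₁ * (B ^ p₂ * N ^ p₃) * (N ^ q₁ * (B ^ q₂ * N ^ q₃))
      ≡⟨ regroup (N ^ p₁) (B ^ p₂) (N ^ p₃) (N ^ q₁) (B ^ q₂) (N ^ q₃) ⟩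
    N ^ p₁ * N ^ p₃ * (N ^ q₁ * N ^ q₃) * (B ^ p₂ * B ^ q₂)
      ≡⟨ cong₂ _*_ (trans (^-distribˡ-+-* N (p₁ + p₃) (q₁ + q₃)) (cong₂ _*_ (^-distribˡ-+-* N p₁ p₃) (^-distribˡ-+-* N q₁ q₃)))
                   (^-distribˡ-+-* B p₂ q₂) ⟨
    N ^ (p₁ + p₃ + (q₁ + q₃)) * B ^ (p₂ + q₂)
      ≤⟨ pow-trade {{N≢0 leN}} B≤N {p₁ + p₃ + (q₁ + q₃)} (p₂ + q₂) 2≤ total ⟩
    N ^ D * B ^ 2 ∎
    where
    U = U₁ , U₂ , U₃
    leN' : 3 * (length (U₁ ++ U₂ ++ U₃) + d) + 2 ≤ N
    leN' = subst (λ u → 3 * (length u + d) + 2 ≤ N) (sym (windows-concat us i)) leN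
    leB' : 3 * (length U₂ + d) + 2 ≤ B
    leB' = ≤-trans (+-monoˡ-≤ 2 (*-monoʳ-≤ 3 (+-monoˡ-≤ d (windows-middle us short i)))) leB
    total : p₁ + p₃ + (q₁ + q₃) + (p₂ + q₂) ≤ D + 2
    total = begin
      p₁ + p₃ + (q₁ + q₃) + (p₂ + q₂)        ≡⟨ shuffle p₁ p₂ p₃ q₁ q₂ q₃ ⟩
      p₁ + (p₂ + p₃) + (q₁ + (q₂ + q₃))      ≤⟨ +-mono-≤ p≤ q≤ ⟩
      d + d                                  ≡⟨ D≡ ⟨
      D + 2                                  ∎
      where
      shuffle : ∀ a b c e f g → a + c + (e + g) + (b + f) ≡ a + (b + c) + (e + (f + g))
      shuffle = solve-∀
    regroup : ∀ a b c e f g → a * (b * c) * (e * (f * g)) ≡ a * c * (e * g) * (b * f)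
    regroup = solve-∀

_≟ʷ_ : DecidableEquality Word
_≟ʷ_ = ≡-dec Boolₚ._≟_

open DecMembership _≟ʷ_ using (_∈?_)

-- Words with aperiodic blocks

words : ℕ → List Word
words zero = [] ∷ []
words (suc n) = map (false ∷_) (words n) ++ map (true ∷_) (words n)

length-words : ∀ n → length (words n) ≡ 2 ^ n
length-words zero = refl
length-words (suc n) = trans (length-++ (map (false ∷_) (words n)))
  (cong₂ _+_ (trans (length-map _ (words n)) (length-words n))
             (trans (length-map _ (words n)) (trans (length-words n) (sym (+-identityʳ _)))))

words-unique : ∀ n → Unique (words n)
words-unique zero = [] ∷ []
words-unique (suc n) = Uniqueₚ.++⁺ (Uniqueₚ.map⁺ ∷-injectiveʳ (words-unique n)) (Uniqueₚ.map⁺ ∷-injectiveʳ (words-unique n)) disjoint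
  where
  disjoint : ∀ {w} → w ∈ map (false ∷_) (words n) × w ∈ map (true ∷_) (words n) → ⊥
  disjoint (i , j) with _ , _ , refl ← ∈-map⁻ _ i with _ , _ , () ← ∈-map⁻ _ j

∈-words-length : ∀ n {w} → w ∈ words n → length w ≡ n
∈-words-length zero (here refl) = refl
∈-words-length (suc n) i with ∈-++⁻ (map (false ∷_) (words n)) i
... | inj₁ j with _ , j' , refl ← ∈-map⁻ _ j = cong suc (∈-words-length n j')
... | inj₂ j with _ , j' , refl ← ∈-map⁻ _ j = cong suc (∈-words-length n j')

shortWords : ℕ → List Word
shortWords zero = [] ∷ []
shortWords (suc r) = [] ∷ map (false ∷_) (shortWords r) ++ map (true ∷_) (shortWords r)

length-shortWords : ∀ r → suc (length (shortWords r)) ≡ 2 ^ suc r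
length-shortWords zero = refl
length-shortWords (suc r) = trans
  (cong (2 +_) (trans (length-++ (map (false ∷_) (shortWords r))) (cong₂ _+_ (length-map _ (shortWords r)) (length-map _ (shortWords r)))))
  (trans (double (length (shortWords r))) (cong (2 *_) (length-shortWords r)))
  where
  double : ∀ a → 2 + (a + a) ≡ 2 * (1 + a)
  double = solve-∀

∈-shortWords : ∀ r x → length x ≤ r → x ∈ shortWords r
∈-shortWords zero [] _ = here refl
∈-shortWords (suc r) [] _ = here refl
∈-shortWords (suc r) (false ∷ x) (s≤s le) = there (∈-++⁺ˡ (∈-map⁺ _ (∈-shortWords r x le)))
∈-shortWords (suc r) (true ∷ x) (s≤s le) = there (∈-++⁺ʳ (map (false ∷_) (shortWords r)) (∈-map⁺ _ (∈-shortWords r x le)))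

-- The prefix of length l of x ++ x ++ x ++ ⋯; junk value [] for empty x.
periodic : ℕ → Word → Word
periodic zero x = []
periodic (suc l) [] = []
periodic (suc l) (c ∷ x) = c ∷ periodic l (x ++ c ∷ [])

-- The first letter of x is the first letter of u; moving it to the end of x leaves the same
-- equation for the rest of u.
periodic-prefix : ∀ u x {z} → 1 ≤ length x → x ++ u ≡ u ++ z → u ≡ periodic (length u) x
periodic-prefix [] x _ eq = refl
periodic-prefix (c ∷ u) (c' ∷ x) _ eq with refl ← ∷-injectiveˡ eq = cong (c ∷_)
  (periodic-prefix u (x ++ c ∷ []) (≤-trans (m≤n+m 1 (length x)) (≤-reflexive (sym (length-++ x))))
    (trans (++-assoc x (c ∷ []) u) (∷-injectiveʳ eq)))

periodicWords : ℕ → ℕ → List Word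
periodicWords r l = map (periodic l) (shortWords r)

aperiodicWords : ℕ → ℕ → List Word
aperiodicWords r l = filter (λ u → ¬? (u ∈? periodicWords r l)) (words l)

aperiodicWords-unique : ∀ r l → Unique (aperiodicWords r l)
aperiodicWords-unique r l = Uniqueₚ.filter⁺ _ (words-unique l)

∈-aperiodicWords : ∀ r l {u} → u ∈ aperiodicWords r l → length u ≡ l × Aperiodic r u
∈-aperiodicWords r l {u} i with j , ¬per ← ∈-filter⁻ (λ u → ¬? (u ∈? periodicWords r l)) {xs = words l} i
  with refl ← ∈-words-length l j = refl , λ x z 1≤ ≤r eq →
    ¬per (subst (_∈ periodicWords r l) (sym (periodic-prefix u x 1≤ eq)) (∈-map⁺ (periodic l) (∈-shortWords r x ≤r)))

length-aperiodicWords-≤ : ∀ r l → length (aperiodicWords r l) ≤ 2 ^ l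
length-aperiodicWords-≤ r l = ≤-trans
  (unique-length-≤ (aperiodicWords-unique r l) (λ i → proj₁ (∈-filter⁻ (λ u → ¬? (u ∈? periodicWords r l)) {xs = words l} i)))
  (≤-reflexive (length-words l))

-- A word with a period of at most r is determined by its length and a word of length at most r, of
-- which there are 2^(r+1) - 1, whatever l is.
length-aperiodicWords-≥ : ∀ r l → 2 ^ l ≤ length (aperiodicWords r l) + 2 ^ suc r
length-aperiodicWords-≥ r l = begin
  2 ^ l                                             ≡⟨ length-words l ⟨
  length (words l)                                  ≤⟨ unique-length-≤ (words-unique l) cover ⟩
  length (aperiodicWords r l ++ periodicWords r l)  ≡⟨ length-++ (aperiodicWords r l) ⟩
  length (aperiodicWords r l) + length (periodicWords r l)
    ≤⟨ +-monoʳ-≤ (length (aperiodicWords r l)) (≤-trans (≤-reflexive (length-map (periodic l) (shortWords r)))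
         (≤-trans (n≤1+n _) (≤-reflexive (length-shortWords r)))) ⟩
  length (aperiodicWords r l) + 2 ^ suc r           ∎
  where
  open ≤-Reasoning
  cover : ∀ {u} → u ∈ words l → u ∈ aperiodicWords r l ++ periodicWords r l
  cover {u} i with u ∈? periodicWords r l
  ... | yes per = ∈-++⁺ʳ (aperiodicWords r l) per
  ... | no ¬per = ∈-++⁺ˡ (∈-filter⁺ (λ u → ¬? (u ∈? periodicWords r l)) i ¬per)

blockWords : ℕ → List ℕ → List Word
blockWords r [] = [] ∷ []
blockWords r (l ∷ ls) = cartesianProductWith _++_ (aperiodicWords r l) (blockWords r ls)

record Blocks (r : ℕ) (ls : List ℕ) (v : Word) : Set where
  constructor blocks
  field
    us : List Word
    v≡ : v ≡ concat us
    lengths : map length us ≡ ls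
    aperiodic : All (Aperiodic r) us

∈-blockWords : ∀ r ls {v} → v ∈ blockWords r ls → Blocks r ls v
∈-blockWords r [] (here refl) = blocks [] refl refl []
∈-blockWords r (l ∷ ls) i
  with u , v , i₁ , i₂ , refl ← ∈-cartesianProductWith⁻ _++_ (aperiodicWords r l) (blockWords r ls) i
  with len , ap ← ∈-aperiodicWords r l i₁ | blocks us refl lens aps ← ∈-blockWords r ls i₂
  = blocks (u ∷ us) refl (cong₂ _∷_ len lens) (ap ∷ aps)

length-concat : ∀ (us : List Word) → length (concat us) ≡ sum (map length us)
length-concat [] = refl
length-concat (u ∷ us) = trans (length-++ u) (cong (length u +_) (length-concat us))

∈-blockWords-length : ∀ r ls {v} → v ∈ blockWords r ls → length v ≡ sum ls
∈-blockWords-length r ls i with blocks us refl refl _ ← ∈-blockWords r ls i = length-concat us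

++-injective : ∀ (u u' : Word) {v v'} → length u ≡ length u' → u ++ v ≡ u' ++ v' → u ≡ u'
++-injective u u' len eq with x , refl , _ ← ++-prefix u u' eq (≤-reflexive len) with x
... | [] = sym (++-identityʳ u)
... | c ∷ x = ⊥-elim (m≢1+m+n (length u) (trans len (trans (length-++ u) (+-suc (length u) (length x)))))

-- Block lengths are fixed in advance, so a word can be cut into blocks in only one way and is
-- listed only once.
concatenations-unique : ∀ l {us vs} → (∀ {u} → u ∈ us → length u ≡ l) → Unique us → Unique vs → Unique (cartesianProductWith _++_ us vs)
concatenations-unique l len [] uvs = []
concatenations-unique l {u ∷ us} {vs} len (u∉ ∷ uus) uvs = Uniqueₚ.++⁺ (Uniqueₚ.map⁺ (++-cancelˡ u _ _) uvs)
  (concatenations-unique l (λ i → len (there i)) uus uvs) disjoint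
  where
  disjoint : ∀ {w} → w ∈ map (u ++_) vs × w ∈ cartesianProductWith _++_ us vs → ⊥
  disjoint (i , j) with _ , _ , refl ← ∈-map⁻ _ i
    with u' , _ , i' , _ , eq ← ∈-cartesianProductWith⁻ _++_ us vs j
    with refl ← ++-injective u u' (trans (len (here refl)) (sym (len (there i')))) eq = All.lookup u∉ i' refl

blockWords-unique : ∀ r ls → Unique (blockWords r ls)
blockWords-unique r [] = [] ∷ []
blockWords-unique r (l ∷ ls) =
  concatenations-unique l (λ i → proj₁ (∈-aperiodicWords r l i)) (aperiodicWords-unique r l) (blockWords-unique r ls)

-- Bernoulli's inequality (1 − 1/X)^i ≥ 1 − i/X, with i blocks and X the inverse of the proportion of periodic words.
length-blockWords-≥ : ∀ r X ls → All (λ l → 2 ^ suc r * X ≤ 2 ^ l) ls →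
  X * 2 ^ sum ls ≤ length (blockWords r ls) * X + length ls * 2 ^ sum ls
length-blockWords-≥ r X [] [] = ≤-reflexive (base X)
  where
  base : ∀ X → X * 1 ≡ 1 * X + 0
  base = solve-∀
length-blockWords-≥ r X (l ∷ ls) (rare ∷ rares) = begin
  X * 2 ^ (l + sum ls)                        ≡⟨ cong (X *_) (^-distribˡ-+-* 2 l (sum ls)) ⟩
  X * (T * S)                                 ≡⟨ e₁ X T S ⟩
  T * X * S                                   ≤⟨ *-monoˡ-≤ S TX≤ ⟩
  (g * X + T) * S                             ≡⟨ e₂ g X T S ⟩
  g * (X * S) + T * S                         ≤⟨ +-monoˡ-≤ (T * S) (*-monoʳ-≤ g (length-blockWords-≥ r X ls rares)) ⟩
  g * (b * X + i * S) + T * S                 ≡⟨ e₃ g b X i S T ⟩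
  g * b * X + (g * (i * S) + T * S)           ≤⟨ +-monoʳ-≤ (g * b * X) (+-monoˡ-≤ (T * S) (*-monoˡ-≤ (i * S) (length-aperiodicWords-≤ r l))) ⟩
  g * b * X + (T * (i * S) + T * S)           ≡⟨ e₄ (g * b * X) T i S ⟩
  g * b * X + suc i * (T * S)                 ≡⟨ cong₂ (λ a c → a * X + suc i * c) (length-cartesianProductWith _++_ (aperiodicWords r l) (blockWords r ls)) (^-distribˡ-+-* 2 l (sum ls)) ⟨
  length (blockWords r (l ∷ ls)) * X + suc i * 2 ^ (l + sum ls) ∎
  where
  open ≤-Reasoning
  T = 2 ^ l
  S = 2 ^ sum ls
  g = length (aperiodicWords r l)
  b = length (blockWords r ls)
  i = length ls
  TX≤ : T * X ≤ g * X + T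
  TX≤ = ≤-trans (*-monoˡ-≤ X (length-aperiodicWords-≥ r l))
    (≤-trans (≤-reflexive (*-distribʳ-+ X g (2 ^ suc r))) (+-monoʳ-≤ (g * X) rare))
  e₁ : ∀ X T S → X * (T * S) ≡ T * X * S
  e₁ = solve-∀
  e₂ : ∀ g X T S → (g * X + T) * S ≡ g * (X * S) + T * S
  e₂ = solve-∀
  e₃ : ∀ g b X i S T → g * (b * X + i * S) + T * S ≡ g * b * X + (g * (i * S) + T * S)
  e₃ = solve-∀
  e₄ : ∀ a T i S → a + (T * (i * S) + T * S) ≡ a + (1 + i) * (T * S)
  e₄ = solve-∀

-- The deletion graph

close? : ∀ d u v → Dec (∃[ m ] (m < suc d × Edits m u v))
close? d u v = anyUpTo? (λ m → edits? m u v) (suc d)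

adj : ℕ → Word → Word → Bool
adj d u v = does (close? d u v)

adj-sym : ∀ d u v → adj d u v ≡ adj d v u
adj-sym d u v = does-⇔ (mk⇔ (λ (m , m< , e) → m , m< , edits-sym e) (λ (m , m< , e) → m , m< , edits-sym e)) (close? d u v) (close? d v u)

adj⇒edits : ∀ d {u v} → adj d u v ≡ true → ∃[ m ] (m ≤ d × Edits m u v)
adj⇒edits d {u} {v} eq with close? d u v
... | yes (m , s≤s m≤d , e) = m , m≤d , e

edits⇒adj : ∀ {m d u v} → m ≤ d → Edits m u v → adj d u v ≡ true
edits⇒adj {d = d} {u} {v} m≤d e = dec-true (close? d u v) (_ , s≤s m≤d , e)

-- A common subsequence of length at least n - k leaves at most k letters of u to delete and at most
-- k letters of v to insert.
nonadjacent⇒DistGt : ∀ k {n u v} → length u ≡ n → length v ≡ n → adj (2 * k) u v ≡ false → DistGt n k u v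
nonadjacent⇒DistGt k {n} {u} {v} refl v≡ nonadj (w , (w⊆u , w⊆v) , n∸k≤) = close (edits-lcs w⊆u w⊆v)
  where
  open ≤-Reasoning
  n≤ : n ≤ k + length w
  n≤ = ≤-trans (m≤n+m∸n n k) (+-monoʳ-≤ k n∸k≤)
  double : ∀ a b → a + b + (a + b) ≡ 2 * a + 2 * b
  double = solve-∀
  close : ∃[ m ] (Edits m u v × m + 2 * length w ≡ n + length v) → ⊥
  false≢true : false ≢ true
  false≢true ()
  close (m , e , m≡) = false≢true (trans (sym nonadj) (edits⇒adj m≤2k e))
    where
    m≤2k : m ≤ 2 * k
    m≤2k = +-cancelʳ-≤ (2 * length w) m (2 * k) (begin
      m + 2 * length w                ≡⟨ m≡ ⟩
      n + length v                    ≡⟨ cong (n +_) v≡ ⟩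
      n + n                           ≤⟨ +-mono-≤ n≤ n≤ ⟩
      k + length w + (k + length w)   ≡⟨ double k (length w) ⟩
      2 * k + 2 * length w            ∎)

degree-≤ : ∀ d w {V N} → Unique V → 3 * (length w + d) + 2 ≤ N → ∑ (λ v → ⟦ adj d v w ⟧) V ≤ suc d * N ^ d
degree-≤ d w uniq le = ≤-trans
  (count-≤ (λ v → adj d v w) uniq (λ {v} _ eq → let m , m≤d , e = adj⇒edits d {v} {w} eq in ∈-ball m≤d (edits-sym e)))
  (length-ball d w le)

module _ (d L : ℕ) where
  open HardCore (adj d) (adj-sym d) L using (hits²)

  local-edges-≤ : ∀ {D ℓ N B ls v F} → D + 2 ≡ d + d → Blocks (3 * d) ls v → All (_≤ ℓ) ls →
    3 * (length v + d) + 2 ≤ N → 3 * (ℓ + ℓ + d) + 2 ≤ B → B ≤ N →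
    Unique F → All (λ x → adj d v x ≡ true) F →
    hits² F F ≤ length (budgets d) * N ^ d + suc (length ls) * (length (collisionBudgets d) * (N ^ D * B ^ 2))
  local-edges-≤ {D} {ℓ} {N} {B} {F = F} D≡ (blocks us refl refl aps) short leN leB B≤N uniq nbrs = begin
    hits² F F
      ≡⟨ ∑-cartesianProduct (λ (x , y) → ⟦ adj d x y ⟧) F F ⟨
    ∑ (λ (x , y) → ⟦ adj d x y ⟧) (cartesianProduct F F)
      ≤⟨ count-≤ (λ (x , y) → adj d x y) (Uniqueₚ.cartesianProduct⁺ uniq uniq) (λ { {x , y} → pair x y }) ⟩
    length (cheapPairs d (concat us) ++ collidingPairs d us)
      ≡⟨ length-++ (cheapPairs d (concat us)) ⟩
    length (cheapPairs d (concat us)) + length (collidingPairs d us)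
      ≤⟨ +-mono-≤ (length-cheapPairs d (concat us) leN) (length-collidingPairs us D≡ (Allₚ.map⁻ short) leN leB B≤N) ⟩
    length (budgets d) * N ^ d + suc (length us) * (length (collisionBudgets d) * (N ^ D * B ^ 2))
      ≡⟨ cong (λ i → length (budgets d) * N ^ d + suc i * (length (collisionBudgets d) * (N ^ D * B ^ 2))) (length-map length us) ⟨
    length (budgets d) * N ^ d + suc (length (map length us)) * (length (collisionBudgets d) * (N ^ D * B ^ 2)) ∎
    where
    open ≤-Reasoning
    threefold : ∀ d → d + d + d ≡ 3 * d
    threefold = solve-∀
    pair : ∀ x y → (x , y) ∈ cartesianProduct F F → adj d x y ≡ true → (x , y) ∈ cheapPairs d (concat us) ++ collidingPairs d us
    pair x y i xy
      with x∈ , y∈ ← ∈-cartesianProduct⁻ F F i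
      with m₁ , m₁≤ , e₁ ← adj⇒edits d (All.lookup nbrs x∈)
         | m₂ , m₂≤ , e₂ ← adj⇒edits d (All.lookup nbrs y∈)
         | m₃ , m₃≤ , e₃ ← adj⇒edits d {x} {y} xy
      -- Three alignments of at most d edits each: this is why blocks are taken aperiodic up to
      -- `3 * d`.
      with triangle us aps (≤-trans (+-mono-≤ (+-mono-≤ m₁≤ m₂≤) m₃≤) (≤-reflexive (threefold d))) e₁ e₂ e₃
    ... | inj₁ le = ∈-++⁺ˡ (∈-cheapPairs (≤-trans le m₃≤) e₁ e₂)
    ... | inj₂ c = ∈-++⁺ʳ (cheapPairs d (concat us)) (∈-collidingPairs m₁≤ m₂≤ c)

AllPairs-resp-⊆ : ∀ {A : Set} {R : A → A → Set} {xs ys : List A} → xs ⊆ ys → AllPairs R ys → AllPairs R xs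
AllPairs-resp-⊆ [] [] = []
AllPairs-resp-⊆ (y ∷ʳ s) (_ ∷ ps) = AllPairs-resp-⊆ s ps
AllPairs-resp-⊆ (refl ∷ s) (p ∷ ps) = Subₚ.All-resp-⊆ s p ∷ AllPairs-resp-⊆ s ps

nonadjacent⇒code : ∀ k {n C} → All (λ u → length u ≡ n) C → Unique C → AllPairs (λ u v → adj (2 * k) u v ≡ false) C → IsDeletionCode n k C
nonadjacent⇒code k {n} lens uniq nonadj = lens , uniq , distant lens nonadj
  where
  distant : ∀ {C} → All (λ u → length u ≡ n) C → AllPairs (λ u v → adj (2 * k) u v ≡ false) C → AllPairs (DistGt n k) C
  distant [] [] = []
  distant (len ∷ lens) (p ∷ ps) = All.zipWith (λ (len' , q) → nonadjacent⇒DistGt k len len' q) (lens , p) ∷ distant lens ps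

large-code : ∀ k {D ℓ N B} t K H .{{_ : NonZero H}} ls .{{_ : NonZero (length ls)}} → let d = 2 * k ; n = sum ls in
  D + 2 ≡ d + d → All (_≤ ℓ) ls → 3 * (n + d) + 2 ≤ N → 3 * (ℓ + ℓ + d) + 2 ≤ B → B ≤ N →
  All (λ l → 2 ^ suc (3 * d) * (2 * length ls) ≤ 2 ^ l) ls →
  length (budgets d) * N ^ d + suc (length ls) * (length (collisionBudgets d) * (N ^ D * B ^ 2)) ≤ 2 * H * (2 * H) →
  t * (1 + 2 * H * 2 ^ (8 * t + 4)) ≤ K →
  ∃[ C ] (IsDeletionCode n k C × 2 ^ n * t ≤ 2 * ((K + suc d * N ^ d) * length C))
large-code k {D} {ℓ} {N} {B} t K H ls D≡ short leN leB B≤N rare sparse t≤K = finish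
  (HardCore.large-independent-set (adj d) (adj-sym d) (2 * H) _≟ʷ_ H refl t K (suc d * N ^ d) t≤K V uniq
    (λ {w} i → degree-≤ d w uniq (subst (λ z → 3 * (z + d) + 2 ≤ N) (sym (len i)) leN))
    (λ {v} i {F} F⊆V nbrs → ≤-trans
      (local-edges-≤ d (2 * H) D≡ (∈-blockWords (3 * d) ls i) short
        (subst (λ z → 3 * (z + d) + 2 ≤ N) (sym (len i)) leN) leB B≤N (AllPairs-resp-⊆ F⊆V uniq) nbrs)
      sparse))
  where
  open ≤-Reasoning
  d = 2 * k
  n = sum ls
  i = length ls
  V = blockWords (3 * d) ls
  uniq : Unique V
  uniq = blockWords-unique (3 * d) ls
  len : ∀ {v} → v ∈ V → length v ≡ n
  len = ∈-blockWords-length (3 * d) ls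
  half : 2 ^ n ≤ 2 * length V
  half = *-cancelʳ-≤ _ _ i (+-cancelʳ-≤ (i * 2 ^ n) _ _ (begin
    2 ^ n * i + i * 2 ^ n           ≡⟨ double (2 ^ n) i ⟩
    -- The choice X = 2i makes the loss of i/X in Bernoulli's inequality equal to one half.
    2 * i * 2 ^ n                   ≤⟨ length-blockWords-≥ (3 * d) (2 * i) ls rare ⟩
    length V * (2 * i) + i * 2 ^ n  ≡⟨ cong (_+ i * 2 ^ n) (shuffle (length V) i) ⟩
    2 * length V * i + i * 2 ^ n    ∎))
    where
    double : ∀ a i → a * i + i * a ≡ 2 * i * a
    double = solve-∀
    shuffle : ∀ a i → a * (2 * i) ≡ 2 * a * i
    shuffle = solve-∀
  finish : ∃[ I ] (I ⊆ V × AllPairs (λ x y → adj d x y ≡ false) I × length V * t ≤ (K + suc d * N ^ d) * length I) →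
    ∃[ C ] (IsDeletionCode n k C × 2 ^ n * t ≤ 2 * ((K + suc d * N ^ d) * length C))
  finish (I , I⊆V , indep , large) = I ,
    nonadjacent⇒code k (Subₚ.All-resp-⊆ I⊆V (All.tabulate len)) (AllPairs-resp-⊆ I⊆V uniq) indep , (begin
      2 ^ n * t                                   ≤⟨ *-monoˡ-≤ t half ⟩
      2 * length V * t                            ≡⟨ *-assoc 2 (length V) t ⟩
      2 * (length V * t)                          ≤⟨ *-monoʳ-≤ 2 large ⟩
      2 * ((K + suc d * N ^ d) * length I)        ∎)

-- Choice of parameters

*-^ : ∀ m n o → (m * n) ^ o ≡ m ^ o * n ^ o
*-^ m n zero = refl
*-^ m n (suc o) = trans (cong (m * n *_) (*-^ m n o)) (interchange m n (m ^ o) (n ^ o))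
  where
  interchange : ∀ a b c e → a * b * (c * e) ≡ a * c * (b * e)
  interchange = solve-∀

n<2^n : ∀ n → n < 2 ^ n
n<2^n zero = s≤s z≤n
n<2^n (suc n) = ≤-trans (+-mono-≤ (m^n>0 2 n) (n<2^n n)) (+-monoʳ-≤ (2 ^ n) (≤-reflexive (sym (+-identityʳ (2 ^ n)))))

sum-replicate : ∀ m q → sum (replicate m q) ≡ m * q
sum-replicate zero q = refl
sum-replicate (suc m) q = cong (q +_) (sum-replicate m q)

block-lengths : ∀ Q .{{_ : NonZero Q}} n → Q * Q ≤ n → n < 16 * (Q * Q) →
  ∃[ ls ] (length ls ≡ Q × sum ls ≡ n × All (Q ≤_) ls × All (_≤ 17 * Q) ls)
-- The first block absorbs the remainder, which is less than Q; the quotient is at most 16 Q, hence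
-- the bound 17 Q.
block-lengths Q@(suc Q') n ≤n n< = (n % Q + n / Q) ∷ replicate Q' (n / Q) ,
  cong suc (length-replicate Q') ,
  trans (cong (n % Q + n / Q +_) (sum-replicate Q' (n / Q))) (trans (+-assoc (n % Q) (n / Q) _)
    (trans (cong (n % Q +_) (*-comm Q (n / Q))) (sym (m≡m%n+[m/n]*n n Q)))) ,
  ≤-trans Q≤q (m≤n+m _ _) ∷ Allₚ.replicate⁺ Q' Q≤q ,
  +-mono-≤ (<⇒≤ (m%n<n n Q)) q≤ ∷ Allₚ.replicate⁺ Q' (≤-trans q≤ (m≤n+m _ Q))
  where
  Q≤q : Q ≤ n / Q
  Q≤q = ≤-trans (≤-reflexive (sym (m*n/n≡m Q Q))) (/-monoˡ-≤ Q ≤n)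
  q≤ : n / Q ≤ 16 * Q
  q≤ = <⇒≤ (m<n*o⇒m/o<n (subst (n <_) (sym (*-assoc 16 Q Q)) n<))

fourth : ℕ → ℕ
fourth j = 2 ^ j * 2 ^ j * (2 ^ j * 2 ^ j)

fourth-suc : ∀ j → fourth (suc j) ≡ 16 * fourth j
fourth-suc j = scale (2 ^ j)
  where
  scale : ∀ p → 2 * p * (2 * p) * (2 * p * (2 * p)) ≡ 16 * (p * p * (p * p))
  scale = solve-∀

fourth-≡ : ∀ j → fourth j ≡ 2 ^ (4 * j)
fourth-≡ j = trans (cong₂ _*_ (sym (^-distribˡ-+-* 2 j j)) (sym (^-distribˡ-+-* 2 j j)))
  (trans (sym (^-distribˡ-+-* 2 (j + j) (j + j))) (cong (2 ^_) (quadruple j)))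
  where
  quadruple : ∀ j → j + j + (j + j) ≡ 4 * j
  quadruple = solve-∀

-- Descent from the scale `e + J`, known to lie above n, to the largest one not above n.
scale-of : ∀ e J n → fourth J ≤ n → n < fourth (e + J) → ∃[ j ] (J ≤ j × fourth j ≤ n × n < fourth (suc j))
scale-of zero J n le lt = ⊥-elim (<⇒≱ lt le)
scale-of (suc e) J n le lt with n <? fourth (e + J)
... | yes lt' = scale-of e J n le lt'
... | no ≮ = e + J , m≤n+m J e , ≮⇒≥ ≮ , lt

n<fourth : ∀ n → n < fourth n
n<fourth n = ≤-trans (n<2^n n) (≤-trans (square (2 ^ n) (m^n>0 2 n)) (square (2 ^ n * 2 ^ n) (*-mono-≤ (m^n>0 2 n) (m^n>0 2 n))))
  where
  square : ∀ a → 1 ≤ a → a ≤ a * a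
  square a 1≤a = ≤-trans (≤-reflexive (sym (*-identityʳ a))) (*-monoʳ-≤ a 1≤a)

fourth-mono : ∀ {i j} → i ≤ j → fourth i ≤ fourth j
fourth-mono {i} {j} le = *-mono-≤ (*-mono-≤ p p) (*-mono-≤ p p)
  where p = ^-monoʳ-≤ 2 le

linear≤square : ∀ {j} → 2 ≤ j → 3 * j ≤ 2 ^ j * 2 ^ j
linear≤square {j} 2≤j = *-mono-≤ (≤-trans (n≤1+n 3) (^-monoʳ-≤ 2 2≤j)) (<⇒≤ (n<2^n j))

-- The proportion of periodic words decays exponentially in the block length, at least 4^j, while
-- the number of blocks is only 4^j; hence even the union over all blocks is rare.
rare-periodic : ∀ d j l → 3 * d + 9 ≤ j → 2 ^ j * 2 ^ j ≤ l → 2 ^ suc (3 * d) * (2 * (2 ^ j * 2 ^ j)) ≤ 2 ^ l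
rare-periodic d j l J≤j Q≤l = begin
  2 ^ suc (3 * d) * (2 * (2 ^ j * 2 ^ j))      ≡⟨ cong (λ z → 2 ^ suc (3 * d) * (2 * z)) (^-distribˡ-+-* 2 j j) ⟨
  2 ^ suc (3 * d) * 2 ^ suc (j + j)            ≡⟨ ^-distribˡ-+-* 2 (suc (3 * d)) (suc (j + j)) ⟨
  2 ^ (suc (3 * d) + suc (j + j))              ≤⟨ ^-monoʳ-≤ 2 exponent ⟩
  2 ^ l                                        ∎
  where
  open ≤-Reasoning
  exponent : suc (3 * d) + suc (j + j) ≤ l
  exponent = begin
    suc (3 * d) + suc (j + j)       ≡⟨ reorder (3 * d) j ⟩
    3 * d + 2 + (j + j)             ≤⟨ +-monoˡ-≤ (j + j) (≤-trans (+-monoʳ-≤ (3 * d) (m≤m+n 2 7)) J≤j) ⟩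
    j + (j + j)                     ≡⟨ thrice j ⟩
    3 * j                           ≤⟨ linear≤square (≤-trans (≤-trans (m≤m+n 2 7) (m≤n+m 9 (3 * d))) J≤j) ⟩
    2 ^ j * 2 ^ j                   ≤⟨ Q≤l ⟩
    l                               ∎
    where
    reorder : ∀ a j → 1 + a + (1 + (j + j)) ≡ a + 2 + (j + j)
    reorder = solve-∀
    thrice : ∀ j → j + (j + j) ≡ 3 * j
    thrice = solve-∀

-- The constant in the edge count: `β` and `γ` are the numbers of cheap and of colliding budgets,
-- and the 2 absorbs the additional window in `suc Q`.
edgeFactor : ℕ → ℕ → ℕ → ℕ → ℕ → ℕ
edgeFactor a d D β γ = β * a ^ d + 2 * (γ * (a ^ D * (a * a)))

-- With P = 2^j and d = 2k, P⁴ ≤ n < 16 P⁴; a word has Q blocks, Z = P^(4d) is of order n^d and Y = Z / P is the order of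
-- the inverse fugacity. N and B bound the number of single edits of a word and of two adjacent blocks.
module Scale (a d d' : ℕ) (d≡ : d ≡ 2 + d') (P : ℕ) .{{_ : NonZero P}} where

  Q = P * P
  -- As d = 2 + d', this exponent is 4d - 1, and `D` below is 2d - 2, both written without
  -- subtraction.
  Y = P ^ (7 + 4 * d')
  Z = (Q * Q) ^ d
  D = 2 + 2 * d'
  N = a * (Q * Q)
  B = a * Q

  1≤P : 1 ≤ P
  1≤P = >-nonZero⁻¹ P

  1≤Q : 1 ≤ Q
  1≤Q = *-mono-≤ 1≤P 1≤P

  D≡ : D + 2 ≡ d + d
  D≡ rewrite d≡ = twice d'
    where
    twice : ∀ e → 2 + 2 * e + 2 ≡ 2 + e + (2 + e)
    twice = solve-∀

  Z≡ : Z ≡ P * Y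
  Z≡ = trans (*-^ Q Q d) (trans (sym (^-distribˡ-+-* Q d d)) (trans (*-^ P P (d + d))
         (trans (sym (^-distribˡ-+-* P (d + d) (d + d))) (cong (P ^_) exponent))))
    where
    count : ∀ e → 2 + e + (2 + e) + (2 + e + (2 + e)) ≡ 1 + (7 + 4 * e)
    count = solve-∀
    exponent : d + d + (d + d) ≡ suc (7 + 4 * d')
    exponent rewrite d≡ = count d'

  -- This equation dictates the fugacity: Q windows, D unrestricted edits and two edits confined to
  -- a window give P^(2 + 4D + 4) = P^(8d - 2) colliding pairs, up to constants.
  Y²≡ : Q * (Q * Q) ^ D * (Q * Q) ≡ Y * Y
  Y²≡ = begin
    Q * (Q * Q) ^ D * (Q * Q)      ≡⟨ cong (λ z → Q * z * (Q * Q)) (trans (*-^ Q Q D) (sym (^-distribˡ-+-* Q D D))) ⟩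
    Q * Q ^ (D + D) * (Q * Q)      ≡⟨ reorder Q (Q ^ (D + D)) ⟩
    Q * (Q * (Q * Q ^ (D + D)))    ≡⟨ cong (Q ^_) (count d') ⟩
    Q ^ (7 + 4 * d')               ≡⟨ *-^ P P (7 + 4 * d') ⟩
    Y * Y                          ∎
    where
    open ≡-Reasoning
    reorder : ∀ q z → q * z * (q * q) ≡ q * (q * (q * z))
    reorder = solve-∀
    count : ∀ e → 3 + (2 + 2 * e + (2 + 2 * e)) ≡ 7 + 4 * e
    count = solve-∀

  1≤Y : 1 ≤ Y
  1≤Y = m^n>0 P (7 + 4 * d')

  Z≤Y² : Z ≤ Y * Y
  Z≤Y² = ≤-trans (≤-reflexive Z≡) (*-monoˡ-≤ Y (≤-trans (≤-reflexive (sym (*-identityʳ P))) (^-monoʳ-≤ P {1} {7 + 4 * d'} (s≤s z≤n))))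

  N^d≡ : N ^ d ≡ a ^ d * Z
  N^d≡ = *-^ a (Q * Q) d

  few : ∀ β γ → β * N ^ d + suc Q * (γ * (N ^ D * B ^ 2)) ≤ edgeFactor a d D β γ * (Y * Y)
  few β γ = begin
    β * N ^ d + suc Q * (γ * (N ^ D * B ^ 2))
      ≤⟨ +-mono-≤ first second ⟩
    β * a ^ d * (Y * Y) + 2 * (γ * (a ^ D * (a * a))) * (Y * Y)
      ≡⟨ *-distribʳ-+ (Y * Y) (β * a ^ d) _ ⟨
    edgeFactor a d D β γ * (Y * Y) ∎
    where
    open ≤-Reasoning
    first : β * N ^ d ≤ β * a ^ d * (Y * Y)
    first = begin
      β * N ^ d              ≡⟨ trans (cong (β *_) N^d≡) (sym (*-assoc β (a ^ d) Z)) ⟩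
      β * a ^ d * Z          ≤⟨ *-monoʳ-≤ (β * a ^ d) Z≤Y² ⟩
      β * a ^ d * (Y * Y)    ∎
    second : suc Q * (γ * (N ^ D * B ^ 2)) ≤ 2 * (γ * (a ^ D * (a * a))) * (Y * Y)
    second = begin
      suc Q * (γ * (N ^ D * B ^ 2))                     ≤⟨ *-monoˡ-≤ (γ * (N ^ D * B ^ 2)) (+-monoˡ-≤ Q 1≤Q) ⟩
      (Q + Q) * (γ * (N ^ D * B ^ 2))                   ≡⟨ cong (λ z → (Q + Q) * (γ * (z * B ^ 2))) (*-^ a (Q * Q) D) ⟩
      (Q + Q) * (γ * (a ^ D * (Q * Q) ^ D * B ^ 2))     ≡⟨ cong (λ z → (Q + Q) * (γ * (a ^ D * (Q * Q) ^ D * (B * z)))) (*-identityʳ B) ⟩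
      (Q + Q) * (γ * (a ^ D * (Q * Q) ^ D * (B * B)))   ≡⟨ reorder Q γ (a ^ D) ((Q * Q) ^ D) a ⟩
      2 * (γ * (a ^ D * (a * a))) * (Q * (Q * Q) ^ D * (Q * Q))   ≡⟨ cong (2 * (γ * (a ^ D * (a * a))) *_) Y²≡ ⟩
      2 * (γ * (a ^ D * (a * a))) * (Y * Y)             ∎
      where
      reorder : ∀ q g x z a → (q + q) * (g * (x * z * (a * q * (a * q)))) ≡ 2 * (g * (x * (a * a))) * (q * z * (q * q))
      reorder = solve-∀

  sparse : ∀ β γ → let H = suc (edgeFactor a d D β γ) * Y in β * N ^ d + suc Q * (γ * (N ^ D * B ^ 2)) ≤ 2 * H * (2 * H)
  sparse β γ = begin
    β * N ^ d + suc Q * (γ * (N ^ D * B ^ 2))    ≤⟨ few β γ ⟩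
    e * (Y * Y)                                  ≤⟨ m≤m+n _ _ ⟩
    e * (Y * Y) + (4 + 7 * e + 4 * (e * e)) * (Y * Y)    ≡⟨ expand e Y ⟩
    2 * (suc e * Y) * (2 * (suc e * Y))          ∎
    where
    open ≤-Reasoning
    e = edgeFactor a d D β γ
    expand : ∀ e y → e * (y * y) + (4 + 7 * e + 4 * (e * e)) * (y * y) ≡ 2 * ((1 + e) * y) * (2 * ((1 + e) * y))
    expand = solve-∀

  -- The gap P = Z/Y pays for the exponential loss, since t · 2^(8t) ≤ 2^(9t) ≤ P; this is where t =
  -- j/9 comes from. The 32 is the 2 of L = 2H times the constant 2^4.
  fugacity : ∀ c t → 2 ^ (9 * t) ≤ P → t * (1 + 2 * (c * Y) * 2 ^ (8 * t + 4)) ≤ (1 + 32 * c) * Z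
  fugacity c t P≥ = begin
    t * (1 + 2 * (c * Y) * 2 ^ (8 * t + 4))        ≡⟨ cong (λ z → t * (1 + 2 * (c * Y) * z)) (^-distribˡ-+-* 2 (8 * t) 4) ⟩
    t * (1 + 2 * (c * Y) * (E * 16))               ≤⟨ *-monoʳ-≤ t (+-monoˡ-≤ _ (*-mono-≤ 1≤Y (m^n>0 2 (8 * t)))) ⟩
    t * (Y * E + 2 * (c * Y) * (E * 16))           ≡⟨ collect t Y E c ⟩
    t * E * ((1 + 32 * c) * Y)                     ≤⟨ *-monoˡ-≤ ((1 + 32 * c) * Y) tE≤ ⟩
    P * ((1 + 32 * c) * Y)                         ≡⟨ swap₁ P (1 + 32 * c) Y ⟩
    (1 + 32 * c) * (P * Y)                         ≡⟨ cong ((1 + 32 * c) *_) Z≡ ⟨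
    (1 + 32 * c) * Z                               ∎
    where
    open ≤-Reasoning
    E = 2 ^ (8 * t)
    tE≤ : t * E ≤ P
    tE≤ = begin
      t * E                  ≤⟨ *-monoˡ-≤ E (<⇒≤ (n<2^n t)) ⟩
      2 ^ t * E              ≡⟨ ^-distribˡ-+-* 2 t (8 * t) ⟨
      2 ^ (9 * t)            ≤⟨ P≥ ⟩
      P                      ∎
    collect : ∀ t y e c → t * (y * e + 2 * (c * y) * (e * 16)) ≡ t * e * ((1 + 32 * c) * y)
    collect = solve-∀
    swap₁ : ∀ p x y → p * (x * y) ≡ x * (p * y)
    swap₁ = solve-∀

occupancyFactor : ℕ → ℕ → ℕ → ℕ
occupancyFactor a d D = suc (edgeFactor a d D (length (budgets d)) (length (collisionBudgets d)))

codeFactor : ℕ → ℕ → ℕ → ℕ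
codeFactor a d D = 1 + 32 * occupancyFactor a d D + suc d * a ^ d

-- The constant 107 = 3 · (17 + 17 + 1) + 2 comes from single edits of two adjacent blocks of length
-- at most 17 Q, with room for d ≤ Q further letters.
scale-code : ∀ k d' → 2 * k ≡ 2 + d' → ∀ a → 107 ≤ a → ∀ j n → 3 * (2 * k) + 9 ≤ j →
  fourth j ≤ n → n < fourth (suc j) →
  ∃[ C ] (IsDeletionCode n k C × 2 ^ n * (j / 9) ≤ 2 * (codeFactor a (2 * k) (2 + 2 * d') * n ^ (2 * k) * length C))
scale-code k d' d≡ a 107≤a j n J≤j ≤n n< = build (block-lengths Q n ≤n n<16QQ)
  where
  open ≤-Reasoning
  instance
    P≢0 : NonZero (2 ^ j)
    P≢0 = m^n≢0 2 j
  d = 2 * k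
  t = j / 9
  open Scale a d d' d≡ (2 ^ j)
  instance
    Q≢0 : NonZero Q
    Q≢0 = m*n≢0 (2 ^ j) (2 ^ j)
    H≢0 : NonZero (occupancyFactor a d D * Y)
    H≢0 = m*n≢0 (occupancyFactor a d D) Y {{_}} {{m^n≢0 (2 ^ j) (7 + 4 * d')}}
  n<16QQ : n < 16 * (Q * Q)
  n<16QQ = subst (n <_) (fourth-suc j) n<
  d≤Q : d ≤ Q
  d≤Q = begin
    d               ≤⟨ m≤m+n d _ ⟩
    3 * d           ≤⟨ m≤m+n (3 * d) 9 ⟩
    3 * d + 9       ≤⟨ J≤j ⟩
    j               ≤⟨ <⇒≤ (n<2^n j) ⟩
    2 ^ j           ≡⟨ *-identityʳ (2 ^ j) ⟨
    2 ^ j * 1       ≤⟨ *-monoʳ-≤ (2 ^ j) 1≤P ⟩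
    Q               ∎
  Q≤QQ : Q ≤ Q * Q
  Q≤QQ = ≤-trans (≤-reflexive (sym (*-identityʳ Q))) (*-monoʳ-≤ Q 1≤Q)
  N-bound : 3 * (n + d) + 2 ≤ N
  N-bound = begin
    3 * (n + d) + 2                        ≤⟨ +-mono-≤ (*-monoʳ-≤ 3 (+-mono-≤ (<⇒≤ n<16QQ) (≤-trans d≤Q Q≤QQ))) (*-monoʳ-≤ 2 (≤-trans 1≤Q Q≤QQ)) ⟩
    3 * (16 * (Q * Q) + Q * Q) + 2 * (Q * Q)   ≡⟨ add (Q * Q) ⟩
    53 * (Q * Q)                           ≤⟨ *-monoˡ-≤ (Q * Q) (≤-trans (m≤m+n 53 54) 107≤a) ⟩
    N                                      ∎
    where
    add : ∀ q → 3 * (16 * q + q) + 2 * q ≡ 53 * q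
    add = solve-∀
  B-bound : 3 * (17 * Q + 17 * Q + d) + 2 ≤ B
  B-bound = begin
    3 * (17 * Q + 17 * Q + d) + 2              ≤⟨ +-mono-≤ (*-monoʳ-≤ 3 (+-monoʳ-≤ (17 * Q + 17 * Q) d≤Q)) (*-monoʳ-≤ 2 1≤Q) ⟩
    3 * (17 * Q + 17 * Q + Q) + 2 * Q          ≡⟨ add Q ⟩
    107 * Q                                    ≤⟨ *-monoˡ-≤ Q 107≤a ⟩
    B                                          ∎
    where
    add : ∀ q → 3 * (17 * q + 17 * q + q) + 2 * q ≡ 107 * q
    add = solve-∀
  2^9t≤P : 2 ^ (9 * t) ≤ 2 ^ j
  2^9t≤P = ^-monoʳ-≤ 2 (≤-trans (≤-reflexive (*-comm 9 t)) (m/n*n≤m j 9))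
  factor≤ : (1 + 32 * occupancyFactor a d D) * Z + suc d * N ^ d ≤ codeFactor a d D * n ^ d
  factor≤ = begin
    (1 + 32 * occupancyFactor a d D) * Z + suc d * N ^ d
      ≡⟨ cong ((1 + 32 * occupancyFactor a d D) * Z +_) (trans (cong (suc d *_) N^d≡) (sym (*-assoc (suc d) (a ^ d) Z))) ⟩
    (1 + 32 * occupancyFactor a d D) * Z + suc d * a ^ d * Z
      ≡⟨ *-distribʳ-+ Z (1 + 32 * occupancyFactor a d D) (suc d * a ^ d) ⟨
    codeFactor a d D * Z
      ≤⟨ *-monoʳ-≤ (codeFactor a d D) (^-monoˡ-≤ d ≤n) ⟩
    codeFactor a d D * n ^ d ∎
  build : ∃[ ls ] (length ls ≡ Q × sum ls ≡ n × All (Q ≤_) ls × All (_≤ 17 * Q) ls) →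
    ∃[ C ] (IsDeletionCode n k C × 2 ^ n * t ≤ 2 * (codeFactor a d D * n ^ d * length C))
  build (ls , length≡ , sum≡ , Q≤ , ≤17Q) = conclude
    (large-code k {D} {17 * Q} {N} {B} t ((1 + 32 * occupancyFactor a d D) * Z) (occupancyFactor a d D * Y) ls {{subst NonZero (sym length≡) Q≢0}}
      D≡ ≤17Q (subst (λ s → 3 * (s + d) + 2 ≤ N) (sym sum≡) N-bound) B-bound (*-monoʳ-≤ a Q≤QQ)
      (subst (λ i → All (λ l → 2 ^ suc (3 * d) * (2 * i) ≤ 2 ^ l) ls) (sym length≡) (All.map (λ {l} → rare-periodic d j l J≤j) Q≤))
      (subst (λ i → length (budgets d) * N ^ d + suc i * (length (collisionBudgets d) * (N ^ D * B ^ 2)) ≤ 2 * (occupancyFactor a d D * Y) * (2 * (occupancyFactor a d D * Y)))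
        (sym length≡) (sparse (length (budgets d)) (length (collisionBudgets d))))
      (fugacity (occupancyFactor a d D) t 2^9t≤P))
    where
    conclude : ∃[ C ] (IsDeletionCode (sum ls) k C × 2 ^ sum ls * t ≤ 2 * (((1 + 32 * occupancyFactor a d D) * Z + suc d * N ^ d) * length C)) →
      ∃[ C ] (IsDeletionCode n k C × 2 ^ n * t ≤ 2 * (codeFactor a d D * n ^ d * length C))
    conclude (C , code , large) = C , subst (λ s → IsDeletionCode s k C) sum≡ code ,
      ≤-trans (subst (λ s → 2 ^ s * t ≤ _) sum≡ large) (*-monoʳ-≤ 2 (*-monoˡ-≤ (length C) factor≤))

-- Since n < 2^(4(j+1)), the left side bounds log n. With t = j/9 at least 1, the rounding and the +
-- 1 cost no more than a factor 2.
log-bound : ∀ j → 9 ≤ j → 4 * suc j ≤ 72 * (j / 9)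
log-bound j 9≤j = begin
  4 * suc j                  ≤⟨ *-monoʳ-≤ 4 j<9[t+1] ⟩
  4 * (9 + 9 * t)            ≤⟨ *-monoʳ-≤ 4 (+-monoˡ-≤ (9 * t) (*-monoʳ-≤ 9 1≤t)) ⟩
  4 * (9 * t + 9 * t)        ≡⟨ add t ⟩
  72 * t                     ∎
  where
  open ≤-Reasoning
  t = j / 9
  1≤t : 1 ≤ t
  1≤t = /-monoˡ-≤ 9 9≤j
  j<9[t+1] : j < 9 + 9 * t
  j<9[t+1] = begin-strict
    j                        ≡⟨ m≡m%n+[m/n]*n j 9 ⟩
    j % 9 + t * 9            <⟨ +-monoˡ-< (t * 9) (m%n<n j 9) ⟩
    9 + t * 9                ≡⟨ cong (9 +_) (*-comm t 9) ⟩
    9 + 9 * t                ∎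
  add : ∀ t → 4 * (9 * t + 9 * t) ≡ 72 * t
  add = solve-∀

^-bound : ∀ n e M {R} → n ≤ 2 ^ e → e * M ≤ R → n ^ M ≤ 2 ^ R
^-bound n e M {R} n≤ le = begin
  n ^ M              ≤⟨ ^-monoˡ-≤ M n≤ ⟩
  (2 ^ e) ^ M        ≡⟨ ^-*-assoc 2 e M ⟩
  2 ^ (e * M)        ≤⟨ ^-monoʳ-≤ 2 le ⟩
  2 ^ R              ∎
  where open ≤-Reasoning

log-code : ∀ k j n c → 9 ≤ j → n < fourth (suc j) →
  ∃[ C ] (IsDeletionCode n k C × 2 ^ n * (j / 9) ≤ 2 * (c * n ^ (2 * k) * length C)) →
  ∃[ C ] (IsDeletionCode n k C × n ^ (2 ^ n) ≤ 2 ^ (144 * c * n ^ (2 * k) * length C))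
log-code k j n c 9≤j n< (C , code , large) = C , code ,
  ^-bound n (4 * suc j) (2 ^ n) (≤-trans (<⇒≤ n<) (≤-reflexive (fourth-≡ (suc j)))) (begin
    4 * suc j * 2 ^ n                         ≤⟨ *-monoˡ-≤ (2 ^ n) (log-bound j 9≤j) ⟩
    72 * (j / 9) * 2 ^ n                      ≡⟨ rotate 72 (j / 9) (2 ^ n) ⟩
    72 * (2 ^ n * (j / 9))                    ≤⟨ *-monoʳ-≤ 72 large ⟩
    72 * (2 * (c * n ^ (2 * k) * length C))   ≡⟨ collect 72 2 c (n ^ (2 * k)) (length C) ⟩
    144 * c * n ^ (2 * k) * length C          ∎)
  where
  open ≤-Reasoning
  rotate : ∀ p t x → p * t * x ≡ p * (x * t)
  rotate = solve-∀
  collect : ∀ p q c x l → p * (q * (c * x * l)) ≡ p * q * c * x * l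
  collect = solve-∀

all-scales : ∀ k → 1 ≤ k → ∀ J c →
  (∀ j n → J ≤ j → fourth j ≤ n → n < fourth (suc j) →
    ∃[ C ] (IsDeletionCode n k C × n ^ (2 ^ n) ≤ 2 ^ (c * n ^ (2 * k) * length C))) →
  ∃[ m ] (1 ≤ m × ((n : ℕ) → k ≤ n →
    ∃[ C ] (IsDeletionCode n k C × n ^ (2 ^ n) ≤ 2 ^ (m * (n ^ (2 * k)) * length C))))
all-scales k 1≤k J c large = m , ≤-trans (m^n>0 2 (fourth J)) (m≤n+m _ c) , code
  where
  open ≤-Reasoning
  m = c + 2 ^ fourth J
  code : (n : ℕ) → k ≤ n → ∃[ C ] (IsDeletionCode n k C × n ^ (2 ^ n) ≤ 2 ^ (m * (n ^ (2 * k)) * length C))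
  code n k≤n with n <? fourth J
  -- Below the first admissible scale a single word is enough: the summand `2 ^ fourth J` of `m`
  -- exceeds 2^n, and log n ≤ n ≤ n^(2k).
  ... | yes small = replicate n false ∷ [] , (length-replicate n ∷ [] , [] ∷ [] , [] ∷ []) , ^-bound n n (2 ^ n) (<⇒≤ (n<2^n n)) (begin
    n * 2 ^ n                      ≡⟨ *-comm n (2 ^ n) ⟩
    2 ^ n * n                      ≤⟨ *-mono-≤ (≤-trans (^-monoʳ-≤ 2 (<⇒≤ small)) (m≤n+m _ c)) n≤ ⟩
    m * n ^ (2 * k)                ≡⟨ *-identityʳ _ ⟨
    m * n ^ (2 * k) * 1            ∎)
    where
    n≤ : n ≤ n ^ (2 * k)
    n≤ = ≤-trans (≤-reflexive (sym (*-identityʳ n))) (^-monoʳ-≤ n {{>-nonZero (≤-trans 1≤k k≤n)}} {1} (≤-trans 1≤k (m≤m+n k _)))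
  ... | no ≮ with j , J≤j , ≤n , n< ← scale-of n J n (≮⇒≥ ≮) (<-≤-trans (n<fourth n) (fourth-mono (m≤m+n n J)))
    with C , isCode , bound ← large j n J≤j ≤n n< = C , isCode ,
      ≤-trans bound (^-monoʳ-≤ 2 (*-monoˡ-≤ (length C) (*-monoˡ-≤ (n ^ (2 * k)) (m≤m+n c _))))

all-lengths : ∀ k a → 107 ≤ a →
  ∃[ m ] (1 ≤ m × ((n : ℕ) → suc k ≤ n →
    ∃[ C ] (IsDeletionCode n (suc k) C × n ^ (2 ^ n) ≤ 2 ^ (m * (n ^ (2 * suc k)) * length C))))
all-lengths k a 107≤a = all-scales (suc k) (s≤s z≤n) (3 * (2 * suc k) + 9) (144 * codeFactor a (2 * suc k) (2 + 2 * (2 * k)))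
  (λ j n J≤j ≤n n< → log-code (suc k) j n (codeFactor a (2 * suc k) (2 + 2 * (2 * k))) (≤-trans (m≤n+m 9 (3 * (2 * suc k))) J≤j) n<
    (scale-code (suc k) (2 * k) (*-suc 2 k) a 107≤a j n J≤j ≤n n<))

-- With c_k = 1/m, the last inequality is 2^n log n ≤ m n^(2k) |C| with both sides taken as
-- exponents of 2, which avoids logarithms and real constants.
theorem1p1 : (k : ℕ) → 2 ≤ k →
    ∃[ m ] (1 ≤ m × ((n : ℕ) → k ≤ n →
    ∃[ C ] (IsDeletionCode n k C ×
    n ^ (2 ^ n) ≤ 2 ^ (m * (n ^ (2 * k)) * length C))))
theorem1p1 (suc k) _ = all-lengths k 107 ≤-refl
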